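{- Let $k \geq 2$, let $n = 2^k - 1$, and let $D$ be a perfect independent dominating set of the hypercube $Q_n$. Then: (1) $Q_n - D$ is $(n-1)$-regular and $(n-1)$-connected. (2) If in addition $D$ is a coset of a linear perfect independent dominating set of $Q_n$, then $Q_n - D$ is Hamiltonian if $k = 2$, and edge-bipancyclic if $k \geq 3$. (3) Moreover, $D$ is a smallest such set: every set $S \subseteq V(Q_n)$ such that $Q_n - S$ is $(n-1)$-regular and $(n-1)$-connected satisfies $|S| \geq |D|$.
   Context: The hypercube $Q_n$ has vertex set $V(Q_n) = \mathbb{F}_2^n$ (binary strings of length $n$), two vertices being adjacent iff they differ in exactly one coordinate; $V(Q_n)$ is regarded as a vector space over $\mathbb{F}_2$. For $S \subseteq V(Q_n)$, $Q_n - S$ is the subgraph induced on $V(Q_n)\setminus S$. A perfect independent dominating set (PID set, or perfect code) of a graph is an independent set $D$ of vertices such that every vertex not in $D$ is adjacent to exactly one vertex of $D$ (and, in $Q_n$ with $n = 2^k-1$, such that any two distinct vertices of $D$ are at distance at least $3$, which is automatic). It is linear if it is a linear subspace of $\mathbb{F}_2^n$; a coset of a linear set $D_0$ is a set $D_0 + x$ with $x \in \mathbb{F}_2^n$. A graph $G$ is edge-bipancyclic if for every edge $e$ of $G$ and every even integer $l$ with $4 \leq l \leq |V(G)|$, there is a cycle of length $l$ in $G$ containing $e$. A graph is Hamiltonian if it has a cycle through all its vertices. -}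

module Defs where

open import Data.Bool.Base using (Bool; true; false; _∧_; _xor_; T)
open import Data.Bool.Properties using (T?) renaming (_≟_ to _≟ᵇ_)
open import Data.List.Base as List
  using (List; []; _∷_; _∷ʳ_; length; filter; cartesianProductWith)
open import Data.List.Membership.Propositional using (_∈_)
open import Data.List.Membership.Propositional.Properties
  using (∈-cartesianProductWith⁺)
open import Data.List.Relation.Unary.All using (All; []; _∷_)
open import Data.List.Relation.Unary.AllPairs using ([]; _∷_)
open import Data.List.Relation.Unary.Any using (here; there)
open import Data.List.Relation.Unary.Unique.Propositional using (Unique)
open import Data.List.Relation.Unary.Unique.Propositional.Properties
  using (filter⁺; cartesianProductWith⁺)
open import Data.Nat.Base using (ℕ; zero; suc; _≤_; _<_)
open import Data.Nat.Divisibility using (_∣_)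
import Data.Nat.Properties as ℕ
open import Data.Product using (∃-syntax; ∃!; _×_; _,_; uncurry)
open import Data.Sum.Base using (_⊎_)
open import Data.Vec.Base as Vec using (Vec; []; _∷_; count; zip; zipWith; replicate)
open import Data.Vec.Properties using (∷-injective)
open import Function.Bundles using (_⇔_)
open import Relation.Binary.Construct.Closure.ReflexiveTransitive using (Star)
open import Relation.Binary.Definitions using (Decidable; Symmetric; Irreflexive)
open import Relation.Binary.PropositionalEquality
  using (_≡_; refl; sym; trans; cong)
open import Relation.Nullary.Decidable using (¬?)
open import Relation.Nullary.Negation using (¬_)

-- Sets of vertices are Bool-valued, so that they are decidable and can be counted.
Subset : Set → Set
Subset A = A → Bool

_∈ˢ_ _∉ˢ_ : {A : Set} → A → Subset A → Set
v ∈ˢ S = T (S v)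
v ∉ˢ S = ¬ (v ∈ˢ S)

-- A finite simple graph whose vertices are the entries of the list `vertices`.
-- Adj is given on all of A, but only its restriction to `vertices` is part of
-- the graph; an induced subgraph is thus obtained by shortening the list.
record Graph (A : Set) : Set₁ where
  field
    vertices    : List A
    unique      : Unique vertices
    Adj         : A → A → Set
    adj?        : Decidable Adj
    symmetric   : Symmetric Adj
    irreflexive : Irreflexive _≡_ Adj

open Graph public

module _ {A : Set} where

  order : Graph A → ℕ
  order G = length (vertices G)

  card : Graph A → Subset A → ℕ
  card G S = length (filter (λ v → T? (S v)) (vertices G))

  infixl 6 _−_
  _−_ : Graph A → Subset A → Graph A
  G − S = record
    { vertices    = filter (λ v → ¬? (T? (S v))) (vertices G)
    ; unique      = filter⁺ (λ v → ¬? (T? (S v))) (unique G)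
    ; Adj         = Adj G
    ; adj?        = adj? G
    ; symmetric   = symmetric G
    ; irreflexive = irreflexive G
    }

  Edge : Graph A → A → A → Set
  Edge G u v = u ∈ vertices G × v ∈ vertices G × Adj G u v

  degree : Graph A → A → ℕ
  degree G v = length (filter (adj? G v) (vertices G))

  Regular : ℕ → Graph A → Set
  Regular d G = ∀ {v} → v ∈ vertices G → degree G v ≡ d

  Connected : Graph A → Set
  Connected G = ∀ {u v} → u ∈ vertices G → v ∈ vertices G → Star (Edge G) u v

  -- κ-connected: more than κ vertices, and deleting fewer than κ of them
  -- never disconnects the graph.
  VertexConnected : ℕ → Graph A → Set
  VertexConnected κ G =
    κ < order G × (∀ (X : Subset A) → card G X < κ → Connected (G − X))

  rotate : List A → List A
  rotate []       = []
  rotate (x ∷ xs) = xs ∷ʳ x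

  -- The cyclically consecutive pairs of x₁ ∷ … ∷ xₗ ∷ [], including (xₗ , x₁).
  cyclicPairs : List A → List (A × A)
  cyclicPairs c = List.zip c (rotate c)

  record IsCycle (G : Graph A) (c : List A) : Set where
    field
      length≥3 : 3 ≤ length c
      distinct : Unique c
      edges    : All (uncurry (Edge G)) (cyclicPairs c)

  -- Edges are undirected, so a cycle may traverse uv in either direction.
  PassesThrough : List A → A → A → Set
  PassesThrough c u v = (u , v) ∈ cyclicPairs c ⊎ (v , u) ∈ cyclicPairs c

  Hamiltonian : Graph A → Set
  Hamiltonian G = ∃[ c ] IsCycle G c × (∀ {v} → v ∈ vertices G → v ∈ c)

  EdgeBipancyclic : Graph A → Set
  EdgeBipancyclic G =
    ∀ {u v} → Edge G u v →
    ∀ l → 2 ∣ l → 4 ≤ l → l ≤ order G →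
    ∃[ c ] IsCycle G c × length c ≡ l × PassesThrough c u v

  record IsPerfectIndependentDominating (G : Graph A) (D : Subset A) : Set where
    field
      subset      : ∀ {v} → v ∈ˢ D → v ∈ vertices G
      independent : ∀ {u v} → u ∈ˢ D → v ∈ˢ D → ¬ Adj G u v
      perfect     : ∀ {v} → v ∈ vertices G → v ∉ˢ D →
                    ∃! _≡_ (λ u → u ∈ˢ D × Adj G v u)

𝔽₂^ : ℕ → Set
𝔽₂^ n = Vec Bool n

𝟎 : ∀ {n} → 𝔽₂^ n
𝟎 = replicate _ false

infixl 6 _⊕_
_⊕_ : ∀ {n} → 𝔽₂^ n → 𝔽₂^ n → 𝔽₂^ n
_⊕_ = zipWith _xor_

infixr 7 _·_
_·_ : ∀ {n} → Bool → 𝔽₂^ n → 𝔽₂^ n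
a · v = Vec.map (a ∧_) v

record IsLinear {n} (D : Subset (𝔽₂^ n)) : Set where
  field
    0-mem : 𝟎 ∈ˢ D
    +-mem : ∀ {u v} → u ∈ˢ D → v ∈ˢ D → (u ⊕ v) ∈ˢ D
    ·-mem : ∀ a {v} → v ∈ˢ D → (a · v) ∈ˢ D

_IsCosetOf_ : ∀ {n} → Subset (𝔽₂^ n) → Subset (𝔽₂^ n) → Set
D IsCosetOf D₀ = ∃[ x ] (∀ v → v ∈ˢ D ⇔ (∃[ d ] d ∈ˢ D₀ × v ≡ d ⊕ x))

-- The number of coordinates in which two strings differ.
distance : ∀ {n} → 𝔽₂^ n → 𝔽₂^ n → ℕ
distance u v = count (λ (a , b) → ¬? (a ≟ᵇ b)) (zip u v)

distance-sym : ∀ {n} (u v : 𝔽₂^ n) → distance u v ≡ distance v u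
distance-sym []          []          = refl
distance-sym (false ∷ u) (false ∷ v) = distance-sym u v
distance-sym (false ∷ u) (true  ∷ v) = cong suc (distance-sym u v)
distance-sym (true  ∷ u) (false ∷ v) = cong suc (distance-sym u v)
distance-sym (true  ∷ u) (true  ∷ v) = distance-sym u v

distance-refl : ∀ {n} (u : 𝔽₂^ n) → distance u u ≡ 0
distance-refl []          = refl
distance-refl (false ∷ u) = distance-refl u
distance-refl (true  ∷ u) = distance-refl u

bits : List Bool
bits = false ∷ true ∷ []

strings : ∀ n → List (𝔽₂^ n)
strings zero    = [] ∷ []
strings (suc n) = cartesianProductWith _∷_ bits (strings n)

strings-unique : ∀ n → Unique (strings n)
strings-unique zero    = [] ∷ []
strings-unique (suc n) =
  cartesianProductWith⁺ _∷_ ∷-injective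
    (((λ ()) ∷ []) ∷ [] ∷ []) (strings-unique n)

strings-complete : ∀ {n} (v : 𝔽₂^ n) → v ∈ strings n
strings-complete []          = here refl
strings-complete (false ∷ v) =
  ∈-cartesianProductWith⁺ _∷_ {xs = bits} (here refl) (strings-complete v)
strings-complete (true  ∷ v) =
  ∈-cartesianProductWith⁺ _∷_ {xs = bits} (there (here refl)) (strings-complete v)

Q : ∀ n → Graph (𝔽₂^ n)
Q n = record
  { vertices    = strings n
  ; unique      = strings-unique n
  ; Adj         = λ u v → distance u v ≡ 1
  ; adj?        = λ u v → distance u v ℕ.≟ 1
  ; symmetric   = λ {u} {v} → trans (distance-sym v u)
  ; irreflexive = λ { {u} refl d≡1 → ℕ.0≢1+n (trans (sym (distance-refl u)) d≡1) }
  }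

{-# OPTIONS --safe #-}

module Submission where

-- A perfect code D has minimum distance 3, and (3) is the count of pairs (vertex, element of S
-- dominating it).
--
-- Connectivity holds for every D of minimum distance 3: halve the cube. If the deleted set X is
-- small in both halves, they are connected and some vertex has both copies left over; otherwise
-- one half is free of X, hence connected, and every vertex of the other half reaches it in at
-- most two steps.
--
-- For bipancyclicity, linearity is only used to obtain a word u of weight 3 with D ⊕ u = D. A
-- cycle of length 2a through the edge uv is a path from u to v on 2a vertices, where a = 1 is
-- the edge itself. Halving along coordinates outside the support of u keeps the hypotheses; a
-- path in one half is lengthened by replacing one of its edges xy by the detour through a path
-- from x to y in the other half. The induction starts in Q₄, where one half is the full Q₃ and
-- the other is Q₃ or a 6-cycle (Q₃ minus an antipodal pair).

open import Defs
open import Data.Bool.Base using (Bool; true; false; not; if_then_else_; _∧_; _xor_; T)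
open import Data.Bool.Properties
  using (T?; xor-identityʳ; xor-comm; xor-assoc; ¬-not; not-¬)
  renaming (_≟_ to _≟ᵇ_)
open import Data.Fin.Base using (Fin; zero; suc)
open import Data.List.Base as List using (List; []; _∷_; _++_; _∷ʳ_; length; filter)
open import Data.List.Membership.DecPropositional using () renaming (_∈?_ to member-of?)
open import Data.List.Membership.Propositional using (_∈_)
open import Data.List.Membership.Propositional.Properties
  using (∈-filter⁺; ∈-filter⁻; ∈-map⁻)
import Data.List.Properties as List
open import Data.List.Relation.Binary.Permutation.Propositional using (↭-sym; ↭⇒↭ₛ)
open import Data.List.Relation.Binary.Permutation.Propositional.Properties using (shifts)
open import Data.List.Relation.Binary.Permutation.Setoid.Properties using (Unique-resp-↭)
open import Data.List.Relation.Unary.All as All using (All; []; _∷_)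
open import Data.List.Relation.Unary.AllPairs using ([]; _∷_)
open import Data.List.Relation.Unary.Any as Any using (Any; here; there)
import Data.List.Relation.Unary.Unique.DecPropositional as DecUnique
open import Data.List.Relation.Unary.Unique.Propositional using (Unique)
import Data.List.Relation.Unary.Unique.Propositional.Properties as Unique
open import Data.List.Scans.Base using (scanl)
open import Data.Nat.Base
open import Data.Nat.Divisibility using (divides)
open import Data.Nat.Properties
open import Algebra.Properties.CommutativeSemigroup +-commutativeSemigroup
  using () renaming (interchange to +-interchange)
open import Data.Product using (∃-syntax; ∃!; _×_; _,_; proj₁; proj₂; uncurry)
open import Data.Sum.Base using (_⊎_; inj₁; inj₂)
open import Data.Unit.Base using (⊤; tt)
open import Data.Vec.Base using ([]; _∷_; insertAt; removeAt; lookup)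
open import Data.Vec.Properties
  using (∷-injectiveʳ; ∷-injectiveˡ; insertAt-removeAt; ≡-dec; zipWith-assoc; zipWith-comm)
open import Function.Base using (_∘_; id)
open import Function.Bundles using (Equivalence)
open import Level using (0ℓ)
open import Relation.Binary.Construct.Closure.ReflexiveTransitive as Star
  using (Star; ε; _◅_; _◅◅_)
open import Relation.Binary.PropositionalEquality hiding ([_])
open import Relation.Nullary using (¬_; Dec; yes; no; does; contradiction)
open import Relation.Nullary.Decidable
  using (¬?; _×-dec_; _→-dec_; _⊎-dec_; map′; from-yes; dec-true)
open import Relation.Unary using (Pred; Decidable)

private variable
  m n : ℕ
  f g : 𝔽₂^ n → ℕ
  D   : Subset (𝔽₂^ n)
  F   : Pred (𝔽₂^ n) 0ℓ

-- Hamming distance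

distance-∷ : ∀ b (u v : 𝔽₂^ n) → distance (b ∷ u) (b ∷ v) ≡ distance u v
distance-∷ false u v = refl
distance-∷ true  u v = refl

distance-not∷ : ∀ b (u v : 𝔽₂^ n) → distance (b ∷ u) (not b ∷ v) ≡ suc (distance u v)
distance-not∷ false u v = refl
distance-not∷ true  u v = refl

distance-∷≤ : ∀ b c (u v : 𝔽₂^ n) → distance (b ∷ u) (c ∷ v) ≤ suc (distance u v)
distance-∷≤ false false u v = n≤1+n _
distance-∷≤ false true  u v = ≤-refl
distance-∷≤ true  false u v = ≤-refl
distance-∷≤ true  true  u v = n≤1+n _

distance≡0⇒≡ : (u v : 𝔽₂^ n) → distance u v ≡ 0 → u ≡ v
distance≡0⇒≡ []          []          _  = refl
distance≡0⇒≡ (false ∷ u) (false ∷ v) eq = cong (false ∷_) (distance≡0⇒≡ u v eq)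
distance≡0⇒≡ (true  ∷ u) (true  ∷ v) eq = cong (true ∷_) (distance≡0⇒≡ u v eq)

distance-triangle : (u v w : 𝔽₂^ n) → distance u w ≤ distance u v + distance v w
distance-triangle []          []          []          = z≤n
distance-triangle (false ∷ u) (false ∷ v) (false ∷ w) = distance-triangle u v w
distance-triangle (true  ∷ u) (true  ∷ v) (true  ∷ w) = distance-triangle u v w
distance-triangle (true  ∷ u) (false ∷ v) (false ∷ w) = s≤s (distance-triangle u v w)
distance-triangle (false ∷ u) (true  ∷ v) (true  ∷ w) = s≤s (distance-triangle u v w)
distance-triangle (false ∷ u) (false ∷ v) (true  ∷ w)
  rewrite +-suc (distance u v) (distance v w) = s≤s (distance-triangle u v w)
distance-triangle (true  ∷ u) (true  ∷ v) (false ∷ w)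
  rewrite +-suc (distance u v) (distance v w) = s≤s (distance-triangle u v w)
distance-triangle (false ∷ u) (true  ∷ v) (false ∷ w) =
  ≤-trans (distance-triangle u v w) (+-mono-≤ (n≤1+n _) (n≤1+n _))
distance-triangle (true  ∷ u) (false ∷ v) (true  ∷ w) =
  ≤-trans (distance-triangle u v w) (+-mono-≤ (n≤1+n _) (n≤1+n _))

adjacent-∷ : ∀ b c (u v : 𝔽₂^ n) → distance (b ∷ u) (c ∷ v) ≡ 1 →
             (c ≡ b × distance u v ≡ 1) ⊎ (c ≡ not b × u ≡ v)
adjacent-∷ false false u v eq = inj₁ (refl , eq)
adjacent-∷ true  true  u v eq = inj₁ (refl , eq)
adjacent-∷ false true  u v eq = inj₂ (refl , distance≡0⇒≡ u v (suc-injective eq))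
adjacent-∷ true  false u v eq = inj₂ (refl , distance≡0⇒≡ u v (suc-injective eq))

adjacent-not∷ : ∀ b (u : 𝔽₂^ n) → distance (b ∷ u) (not b ∷ u) ≡ 1
adjacent-not∷ b u = trans (distance-not∷ b u u) (cong suc (distance-refl u))

adjacent-cons : ∀ b (u v : 𝔽₂^ n) → distance u v ≡ 1 → distance (b ∷ u) (b ∷ v) ≡ 1
adjacent-cons b u v = trans (distance-∷ b u v)

-- The witness is `u` with its first differing coordinate flipped. This serves to exclude codewords
-- at distance 2.
midpoint : (u v : 𝔽₂^ n) → distance u v ≡ 2 →
           ∃[ w ] distance u w ≡ 1 × distance w v ≡ 1
midpoint [] [] ()
midpoint (false ∷ u) (false ∷ v) eq with w , p , q ← midpoint u v eq = false ∷ w , p , q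
midpoint (true  ∷ u) (true  ∷ v) eq with w , p , q ← midpoint u v eq = true ∷ w , p , q
midpoint (false ∷ u) (true  ∷ v) eq =
  true ∷ u , cong suc (distance-refl u) , suc-injective eq
midpoint (true  ∷ u) (false ∷ v) eq =
  false ∷ u , cong suc (distance-refl u) , suc-injective eq

-- Sums over the cube and over neighbourhoods

indicator : Bool → ℕ
indicator false = 0
indicator true  = 1

indicator≤1 : ∀ b → indicator b ≤ 1
indicator≤1 false = z≤n
indicator≤1 true  = ≤-refl

indicator-not : ∀ b → indicator b + indicator (not b) ≡ 1
indicator-not false = refl
indicator-not true  = refl

T⇒indicator≡1 : ∀ {b} → T b → indicator b ≡ 1
T⇒indicator≡1 {true} _ = refl

T⇒indicator-not≡0 : ∀ {b} → T b → indicator (not b) ≡ 0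
T⇒indicator-not≡0 {true} _ = refl

¬T⇒indicator≡0 : ∀ {b} → ¬ T b → indicator b ≡ 0
¬T⇒indicator≡0 {false} _  = refl
¬T⇒indicator≡0 {true}  ¬t = contradiction _ ¬t

indicator≡0⇒¬T : ∀ {b} → indicator b ≡ 0 → ¬ T b
indicator≡0⇒¬T {false} _ ()

-- Recursion on the first coordinate makes the sum split over the two halves of the cube by
-- definition; most inductions below halve the cube in this way.
∑ : (𝔽₂^ n → ℕ) → ℕ
∑ {zero}  f = f []
∑ {suc n} f = ∑ (f ∘ (false ∷_)) + ∑ (f ∘ (true ∷_))

∑-mono : (∀ v → f v ≤ g v) → ∑ {n} f ≤ ∑ g
∑-mono {zero}  f≤g = f≤g []
∑-mono {suc n} f≤g = +-mono-≤ (∑-mono (f≤g ∘ (false ∷_))) (∑-mono (f≤g ∘ (true ∷_)))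

∑-cong : (∀ v → f v ≡ g v) → ∑ {n} f ≡ ∑ g
∑-cong f≗g = ≤-antisym (∑-mono (≤-reflexive ∘ f≗g)) (∑-mono (≤-reflexive ∘ sym ∘ f≗g))

∑-+ : ∀ (f g : 𝔽₂^ n → ℕ) → ∑ (λ v → f v + g v) ≡ ∑ f + ∑ g
∑-+ {zero}  f g = refl
∑-+ {suc n} f g = trans
  (cong₂ _+_ (∑-+ (f ∘ (false ∷_)) _) (∑-+ (f ∘ (true ∷_)) _))
  (+-interchange (∑ (f ∘ (false ∷_))) _ _ _)

≤∑ : ∀ f (v : 𝔽₂^ n) → f v ≤ ∑ f
≤∑ f []          = ≤-refl
≤∑ f (false ∷ v) = ≤-trans (≤∑ (f ∘ (false ∷_)) v) (m≤m+n _ _)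
≤∑ f (true  ∷ v) = ≤-trans (≤∑ (f ∘ (true ∷_)) v) (m≤n+m _ _)

∑-∷≤ : ∀ b (f : 𝔽₂^ (suc n) → ℕ) → ∑ (f ∘ (b ∷_)) ≤ ∑ f
∑-∷≤ false f = m≤m+n _ _
∑-∷≤ true  f = m≤n+m _ _

∑-halves : ∀ b (f : 𝔽₂^ (suc n) → ℕ) → ∑ f ≡ ∑ (f ∘ (b ∷_)) + ∑ (f ∘ (not b ∷_))
∑-halves false f = refl
∑-halves true  f = +-comm (∑ (f ∘ (false ∷_))) _

-- Flipping the first coordinate leads to the one neighbour in the other half; the recursive call
-- stays in the half of the vertex.
∑ᴺ : 𝔽₂^ n → (𝔽₂^ n → ℕ) → ℕ
∑ᴺ []      f = 0
∑ᴺ (b ∷ u) f = f (not b ∷ u) + ∑ᴺ u (f ∘ (b ∷_))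

∑ᴺ-mono : ∀ (u : 𝔽₂^ n) → (∀ v → distance u v ≡ 1 → f v ≤ g v) → ∑ᴺ u f ≤ ∑ᴺ u g
∑ᴺ-mono []      f≤g = z≤n
∑ᴺ-mono (b ∷ u) f≤g = +-mono-≤ (f≤g _ (adjacent-not∷ b u))
  (∑ᴺ-mono u (λ v → f≤g (b ∷ v) ∘ adjacent-cons b u v))

∑ᴺ-cong : ∀ (u : 𝔽₂^ n) → (∀ v → distance u v ≡ 1 → f v ≡ g v) → ∑ᴺ u f ≡ ∑ᴺ u g
∑ᴺ-cong u f≗g = ≤-antisym (∑ᴺ-mono u (λ v → ≤-reflexive ∘ f≗g v))
                          (∑ᴺ-mono u (λ v → ≤-reflexive ∘ sym ∘ f≗g v))

∑ᴺ-+ : ∀ (u : 𝔽₂^ n) f g → ∑ᴺ u (λ v → f v + g v) ≡ ∑ᴺ u f + ∑ᴺ u g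
∑ᴺ-+ []      f g = refl
∑ᴺ-+ (b ∷ u) f g = trans (cong (f _ + g _ +_) (∑ᴺ-+ u _ _)) (+-interchange (f _) _ _ _)

∑ᴺ-0 : ∀ (u : 𝔽₂^ n) → ∑ᴺ u (λ _ → 0) ≡ 0
∑ᴺ-0 []      = refl
∑ᴺ-0 (b ∷ u) = ∑ᴺ-0 u

∑ᴺ-1 : ∀ (u : 𝔽₂^ n) → ∑ᴺ u (λ _ → 1) ≡ n
∑ᴺ-1 []      = refl
∑ᴺ-1 (b ∷ u) = cong suc (∑ᴺ-1 u)

≤∑ᴺ : ∀ (u v : 𝔽₂^ n) f → distance u v ≡ 1 → f v ≤ ∑ᴺ u f
≤∑ᴺ [] [] f ()
≤∑ᴺ (b ∷ u) (c ∷ v) f uv with adjacent-∷ b c u v uv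
... | inj₁ (refl , uv′) = ≤-trans (≤∑ᴺ u v (f ∘ (b ∷_)) uv′) (m≤n+m _ _)
... | inj₂ (refl , refl) = m≤m+n _ _

∑ᴺ≤∑ : ∀ (u : 𝔽₂^ n) f → ∑ᴺ u f ≤ ∑ f
∑ᴺ≤∑ []      f = z≤n
∑ᴺ≤∑ (b ∷ u) f = begin
  f (not b ∷ u) + ∑ᴺ u (f ∘ (b ∷_))        ≤⟨ +-mono-≤ (≤∑ (f ∘ (not b ∷_)) u) (∑ᴺ≤∑ u _) ⟩
  ∑ (f ∘ (not b ∷_)) + ∑ (f ∘ (b ∷_))      ≡⟨ +-comm (∑ (f ∘ (not b ∷_))) _ ⟩
  ∑ (f ∘ (b ∷_)) + ∑ (f ∘ (not b ∷_))      ≡⟨ sym (∑-halves b f) ⟩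
  ∑ f                                      ∎
  where open ≤-Reasoning

-- Double counting: `f w` is counted once from each of the `n` neighbours of `w`.
∑-∑ᴺ : ∀ (f : 𝔽₂^ n → ℕ) → ∑ (λ v → ∑ᴺ v f) ≡ n * ∑ f
∑-∑ᴺ {zero}  f = refl
∑-∑ᴺ {suc n} f = begin
  ∑ (λ v → f₁ v + ∑ᴺ v f₀) + ∑ (λ v → f₀ v + ∑ᴺ v f₁)
    ≡⟨ cong₂ _+_ (∑-+ f₁ (λ v → ∑ᴺ v f₀)) (∑-+ f₀ (λ v → ∑ᴺ v f₁)) ⟩
  (∑ f₁ + ∑ (λ v → ∑ᴺ v f₀)) + (∑ f₀ + ∑ (λ v → ∑ᴺ v f₁))
    ≡⟨ cong₂ (λ x y → (∑ f₁ + x) + (∑ f₀ + y)) (∑-∑ᴺ f₀) (∑-∑ᴺ f₁) ⟩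
  (∑ f₁ + n * ∑ f₀) + (∑ f₀ + n * ∑ f₁)
    ≡⟨ +-interchange (∑ f₁) _ _ _ ⟩
  (∑ f₁ + ∑ f₀) + (n * ∑ f₀ + n * ∑ f₁)
    ≡⟨ cong₂ _+_ (+-comm (∑ f₁) _) (sym (*-distribˡ-+ n (∑ f₀) _)) ⟩
  suc n * (∑ f₀ + ∑ f₁) ∎
  where
  open ≡-Reasoning
  f₀ = f ∘ (false ∷_)
  f₁ = f ∘ (true ∷_)

∑ᴺ<n⇒zero : ∀ (u : 𝔽₂^ n) f → ∑ᴺ u f < n → ∃[ v ] distance u v ≡ 1 × f v ≡ 0
∑ᴺ<n⇒zero (b ∷ u) f <n with f (not b ∷ u) in eq
... | zero  = not b ∷ u , adjacent-not∷ b u , eq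
... | suc _ with v , uv , fv≡0 ← ∑ᴺ<n⇒zero u (f ∘ (b ∷_)) (≤-trans (s≤s (m≤n+m _ _)) (s≤s⁻¹ <n))
            = b ∷ v , adjacent-cons b u v uv , fv≡0

∑ᴺ-none : ∀ (u : 𝔽₂^ n) → (∀ v → distance u v ≡ 1 → v ∉ˢ D) → ∑ᴺ u (indicator ∘ D) ≡ 0
∑ᴺ-none u none = trans (∑ᴺ-cong u (λ v uv → ¬T⇒indicator≡0 (none v uv))) (∑ᴺ-0 u)

∑ᴺ-unique : ∀ (u : 𝔽₂^ n) →
            (∀ {v w} → distance u v ≡ 1 → distance u w ≡ 1 → v ∈ˢ D → w ∈ˢ D → v ≡ w) →
            ∑ᴺ u (indicator ∘ D) ≤ 1
∑ᴺ-unique             []      unique = z≤n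
∑ᴺ-unique {D = D} (b ∷ u) unique with T? (D (not b ∷ u))
... | yes d = ≤-reflexive (cong₂ _+_ (T⇒indicator≡1 d)
  (∑ᴺ-none u (λ v uv v∈D → not-¬ refl (sym (∷-injectiveˡ
    (unique (adjacent-not∷ b u) (adjacent-cons b u v uv) d v∈D))))))
... | no ¬d rewrite ¬T⇒indicator≡0 ¬d = ∑ᴺ-unique u (λ {v} {w} uv uw v∈D w∈D →
  ∷-injectiveʳ (unique (adjacent-cons b u v uv) (adjacent-cons b u w uw) v∈D w∈D))

∑ᴺ-complement : ∀ (D : Subset (𝔽₂^ n)) u →
                ∑ᴺ u (indicator ∘ D) + ∑ᴺ u (indicator ∘ not ∘ D) ≡ n
∑ᴺ-complement D u = trans (sym (∑ᴺ-+ u _ _))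
  (trans (∑ᴺ-cong u (λ v _ → indicator-not (D v))) (∑ᴺ-1 u))

-- A degree in `Q n − D` takes this form once its two filters are merged. Crossing to the other half
-- uses up one step, so the count for distance 1 rests on the one for distance 0.
atDistance : ℕ → 𝔽₂^ n → Subset (𝔽₂^ n) → 𝔽₂^ n → ℕ
atDistance k u D v = indicator (D v ∧ does (distance u v ≟ k))

∑-atDistance : ∀ k b (u : 𝔽₂^ n) D →
  ∑ (atDistance k (b ∷ u) D) ≡
  ∑ (atDistance k u (D ∘ (b ∷_))) + ∑ (atDistance k (b ∷ u) D ∘ (not b ∷_))
∑-atDistance k b u D = trans (∑-halves b (atDistance k (b ∷ u) D)) (cong₂ _+_ (∑-cong (λ v →
  cong (λ d → indicator (D (b ∷ v) ∧ does (d ≟ k))) (distance-∷ b u v))) refl)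

∑-atDistance-0 : ∀ (u : 𝔽₂^ n) D → ∑ (atDistance 0 u D) ≡ indicator (D u)
∑-atDistance-0 [] D with D []
... | false = refl
... | true  = refl
∑-atDistance-0 {suc n} (b ∷ u) D = trans (∑-atDistance 0 b u D)
  (trans (cong₂ _+_ (∑-atDistance-0 u (D ∘ (b ∷_))) (trans (∑-cong opposite) (∑-0 n))) (+-identityʳ _))
  where
  ∑-0 : ∀ m → ∑ {m} (λ _ → 0) ≡ 0
  ∑-0 zero    = refl
  ∑-0 (suc m) = cong₂ _+_ (∑-0 m) (∑-0 m)
  opposite : ∀ v → atDistance 0 (b ∷ u) D (not b ∷ v) ≡ 0
  opposite v rewrite distance-not∷ b u v with D (not b ∷ v)
  ... | false = refl
  ... | true  = refl

∑-atDistance-1 : ∀ (u : 𝔽₂^ n) D → ∑ (atDistance 1 u D) ≡ ∑ᴺ u (indicator ∘ D)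
∑-atDistance-1 [] D with D []
... | false = refl
... | true  = refl
∑-atDistance-1 (b ∷ u) D = begin
  ∑ (atDistance 1 (b ∷ u) D)
    ≡⟨ ∑-atDistance 1 b u D ⟩
  ∑ (atDistance 1 u (D ∘ (b ∷_))) + ∑ (atDistance 1 (b ∷ u) D ∘ (not b ∷_))
    ≡⟨ cong₂ _+_ (∑-atDistance-1 u (D ∘ (b ∷_)))
         (trans (∑-cong opposite) (∑-atDistance-0 u (D ∘ (not b ∷_)))) ⟩
  ∑ᴺ u (indicator ∘ D ∘ (b ∷_)) + indicator (D (not b ∷ u))
    ≡⟨ +-comm (∑ᴺ u (indicator ∘ D ∘ (b ∷_))) _ ⟩
  ∑ᴺ (b ∷ u) (indicator ∘ D) ∎
  where
  open ≡-Reasoning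
  opposite : ∀ v → atDistance 1 (b ∷ u) D (not b ∷ v) ≡ atDistance 0 u (D ∘ (not b ∷_)) v
  opposite v = cong (λ d → indicator (D (not b ∷ v) ∧ does (d ≟ 1))) (distance-not∷ b u v)

-- Cardinalities of filtered vertex lists as sums

module _ {A : Set} where

  length-filter-map : ∀ {B : Set} {P : Pred B 0ℓ} (P? : Decidable P) (h : A → B) xs →
                      length (filter P? (List.map h xs)) ≡ length (filter (P? ∘ h) xs)
  length-filter-map P? h []       = refl
  length-filter-map P? h (x ∷ xs) with does (P? (h x))
  ... | false = length-filter-map P? h xs
  ... | true  = cong suc (length-filter-map P? h xs)

  length-filter-filter : ∀ {P R : Pred A 0ℓ} (P? : Decidable P) (R? : Decidable R) xs →
    length (filter R? (filter P? xs)) ≡ length (filter (λ x → T? (does (P? x) ∧ does (R? x))) xs)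
  length-filter-filter P? R? []       = refl
  length-filter-filter P? R? (x ∷ xs) with does (P? x)
  ... | false = length-filter-filter P? R? xs
  ... | true with does (R? x)
  ...   | false = length-filter-filter P? R? xs
  ...   | true  = cong suc (length-filter-filter P? R? xs)

length-filter-strings : {P : Pred (𝔽₂^ n) 0ℓ} (P? : Decidable P) →
                        length (filter P? (strings n)) ≡ ∑ (λ v → indicator (does (P? v)))
length-filter-strings {zero} P? with does (P? [])
... | false = refl
... | true  = refl
length-filter-strings {suc n} P? = begin
  length (filter P? (List.map (false ∷_) xs ++ List.map (true ∷_) xs ++ []))
    ≡⟨ cong (λ ys → length (filter P? (List.map (false ∷_) xs ++ ys))) (List.++-identityʳ _) ⟩
  length (filter P? (List.map (false ∷_) xs ++ List.map (true ∷_) xs))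
    ≡⟨ cong length (List.filter-++ P? (List.map (false ∷_) xs) _) ⟩
  length (filter P? (List.map (false ∷_) xs) ++ filter P? (List.map (true ∷_) xs))
    ≡⟨ List.length-++ (filter P? (List.map (false ∷_) xs)) ⟩
  length (filter P? (List.map (false ∷_) xs)) + length (filter P? (List.map (true ∷_) xs))
    ≡⟨ cong₂ _+_ (trans (length-filter-map P? (false ∷_) xs) (length-filter-strings (P? ∘ (false ∷_))))
                 (trans (length-filter-map P? (true ∷_) xs) (length-filter-strings (P? ∘ (true ∷_)))) ⟩
  ∑ (λ v → indicator (does (P? v))) ∎
  where
  open ≡-Reasoning
  xs = strings n

card-∑ : (S : Subset (𝔽₂^ n)) → card (Q n) S ≡ ∑ (indicator ∘ S)
card-∑ S = length-filter-strings (T? ∘ S)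

order-∑ : (D : Subset (𝔽₂^ n)) → order (Q n − D) ≡ ∑ (indicator ∘ not ∘ D)
order-∑ D = length-filter-strings (λ v → ¬? (T? (D v)))

card-−-∑ : (D X : Subset (𝔽₂^ n)) → card (Q n − D) X ≡ ∑ (λ v → indicator (not (D v) ∧ X v))
card-−-∑ D X = trans (length-filter-filter (λ v → ¬? (T? (D v))) (T? ∘ X) (strings _))
                     (length-filter-strings (λ v → T? (not (D v) ∧ X v)))

degree-∑ᴺ : (D : Subset (𝔽₂^ n)) (u : 𝔽₂^ n) →
            degree (Q n − D) u ≡ ∑ᴺ u (indicator ∘ not ∘ D)
degree-∑ᴺ {n} D u = trans
  (length-filter-filter (λ v → ¬? (T? (D v))) (adj? (Q n) u) (strings n))
  (trans (length-filter-strings (λ v → T? (not (D v) ∧ does (distance u v ≟ 1))))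
         (∑-atDistance-1 u (not ∘ D)))

-- Perfect codes

-- Minimum distance 3. Unlike domination, this passes to both halves of the cube, so the inductions
-- carry it in place of perfection.
Separated : Subset (𝔽₂^ n) → Set
Separated D = ∀ u v → u ∈ˢ D → v ∈ˢ D → distance u v < 3 → u ≡ v

separated-∷ : ∀ b → Separated D → Separated (D ∘ (b ∷_))
separated-∷ b sep u v u∈D v∈D uv<3 =
  ∷-injectiveʳ (sep (b ∷ u) (b ∷ v) u∈D v∈D (subst (_< 3) (sym (distance-∷ b u v)) uv<3))

adjacent⇒≢ : ∀ (u v : 𝔽₂^ n) → distance u v ≡ 1 → ¬ (u ≡ v)
adjacent⇒≢ u v uv refl = contradiction (trans (sym uv) (distance-refl u)) (λ ())

separated⇒independent : Separated D → ∀ u v → distance u v ≡ 1 → u ∈ˢ D → v ∉ˢ D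
separated⇒independent sep u v uv u∈D v∈D =
  adjacent⇒≢ u v uv (sep u v u∈D v∈D (subst (_< 3) (sym uv) (s≤s (s≤s z≤n))))

separated⇒unique : Separated D → ∀ (u : 𝔽₂^ n) {v w} → distance u v ≡ 1 → distance u w ≡ 1 →
                   v ∈ˢ D → w ∈ˢ D → v ≡ w
separated⇒unique sep u {v} {w} uv uw v∈D w∈D = sep v w v∈D w∈D (s≤s (begin
  distance v w                ≤⟨ distance-triangle v u w ⟩
  distance v u + distance u w ≡⟨ cong₂ _+_ (trans (distance-sym v u) uv) uw ⟩
  2                           ∎))
  where open ≤-Reasoning

-- Distance 1 contradicts independence. At distance 2 the midpoint lies outside `D` by independence
-- and would have two neighbours in `D`.
perfect⇒separated : IsPerfectIndependentDominating (Q n) D → Separated D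
perfect⇒separated pid u v u∈D v∈D uv<3 with distance u v in uv
... | 0 = distance≡0⇒≡ u v uv
... | 1 = contradiction uv (IsPerfectIndependentDominating.independent pid u∈D v∈D)
... | 2 with w , uw , wv ← midpoint u v uv
        with IsPerfectIndependentDominating.perfect pid (strings-complete w)
               (λ w∈D → IsPerfectIndependentDominating.independent pid u∈D w∈D uw)
...   | _ , _ , unique =
        trans (sym (unique (u∈D , trans (distance-sym w u) uw))) (unique (v∈D , wv))
perfect⇒separated pid u v u∈D v∈D (s≤s (s≤s (s≤s ()))) | suc (suc (suc _))

perfect⇒∑ᴺ≡1 : IsPerfectIndependentDominating (Q n) D → ∀ v → v ∉ˢ D → ∑ᴺ v (indicator ∘ D) ≡ 1
perfect⇒∑ᴺ≡1 {D = D} pid v v∉D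
  with u , (u∈D , vu) , _ ← IsPerfectIndependentDominating.perfect pid (strings-complete v) v∉D
  = ≤-antisym (∑ᴺ-unique v (separated⇒unique (perfect⇒separated pid) v))
              (subst (_≤ ∑ᴺ v (indicator ∘ D)) (T⇒indicator≡1 u∈D) (≤∑ᴺ v u (indicator ∘ D) vu))

perfect⇒nonempty : IsPerfectIndependentDominating (Q n) D → ∃[ d ] d ∈ˢ D
perfect⇒nonempty {D = D} pid with T? (D 𝟎)
... | yes 𝟎∈D = 𝟎 , 𝟎∈D
... | no  𝟎∉D with u , (u∈D , _) , _ ←
      IsPerfectIndependentDominating.perfect pid (strings-complete 𝟎) 𝟎∉D = u , u∈D

∉⇒vertex : ∀ (v : 𝔽₂^ n) → v ∉ˢ D → v ∈ vertices (Q n − D)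
∉⇒vertex {D = D} v = ∈-filter⁺ (λ v → ¬? (T? (D v))) (strings-complete v)

vertex⇒∉ : ∀ {v : 𝔽₂^ n} → v ∈ vertices (Q n − D) → v ∉ˢ D
vertex⇒∉ {n} {D} = proj₂ ∘ ∈-filter⁻ (λ v → ¬? (T? (D v))) {xs = strings n}

∑ᴺ≡1⇒regular : (∀ v → v ∉ˢ D → ∑ᴺ v (indicator ∘ D) ≡ 1) → Regular (n ∸ 1) (Q n − D)
∑ᴺ≡1⇒regular {n} {D} ∑ᴺ≡1 {v} v∈ = trans (degree-∑ᴺ D v) (begin
  ∑ᴺ v (indicator ∘ not ∘ D)
    -- `1 + s ∸ 1` computes to `s`; the 1 is then rewritten as the number of neighbours in `D`.
    ≡⟨ cong (λ x → (x + ∑ᴺ v (indicator ∘ not ∘ D)) ∸ 1) (sym (∑ᴺ≡1 v (vertex⇒∉ v∈))) ⟩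
  (∑ᴺ v (indicator ∘ D) + ∑ᴺ v (indicator ∘ not ∘ D)) ∸ 1 ≡⟨ cong (_∸ 1) (∑ᴺ-complement D v) ⟩
  n ∸ 1                                                  ∎)
  where open ≡-Reasoning

-- What regularity gives for (3): a remaining vertex keeps all but one of its `suc n` neighbours, so
-- it is dominated exactly once.
regular⇒∑ᴺ≡1 : Regular n (Q (suc n) − D) → ∀ v → v ∉ˢ D → ∑ᴺ v (indicator ∘ D) ≡ 1
regular⇒∑ᴺ≡1 {n} {D} reg v v∉D = +-cancelʳ-≡ n _ 1 (begin
  ∑ᴺ v (indicator ∘ D) + n
    ≡⟨ cong (∑ᴺ v (indicator ∘ D) +_) (trans (sym (reg (∉⇒vertex v v∉D))) (degree-∑ᴺ D v)) ⟩
  ∑ᴺ v (indicator ∘ D) + ∑ᴺ v (indicator ∘ not ∘ D) ≡⟨ ∑ᴺ-complement D v ⟩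
  suc n                                             ∎)
  where open ≡-Reasoning

-- Each element of `D` dominates itself and its `n` neighbours, hence the factor `suc n`.
∑-closed-neighbourhood : ∀ (D : Subset (𝔽₂^ n)) →
  ∑ (λ v → indicator (D v) + ∑ᴺ v (indicator ∘ D)) ≡ suc n * ∑ (indicator ∘ D)
∑-closed-neighbourhood {n} D = trans (∑-+ (indicator ∘ D) _)
  (cong (∑ (indicator ∘ D) +_) (∑-∑ᴺ {n} (indicator ∘ D)))

-- Every vertex is dominated by S at least once, and by a separated D at most once.
separated-card≤ : ∀ (D S : Subset (𝔽₂^ n)) → Separated D →
  (∀ v → v ∉ˢ S → ∑ᴺ v (indicator ∘ S) ≡ 1) → card (Q n) D ≤ card (Q n) S
separated-card≤ {n} D S sep ∑ᴺ≡1 = subst₂ _≤_ (sym (card-∑ D)) (sym (card-∑ S))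
  (*-cancelˡ-≤ (suc n) (begin
    suc n * ∑ (indicator ∘ D)                        ≡⟨ ∑-closed-neighbourhood D ⟨
    ∑ (λ v → indicator (D v) + ∑ᴺ v (indicator ∘ D)) ≤⟨ ∑-mono (λ v → ≤-trans (upper v) (lower v)) ⟩
    ∑ (λ v → indicator (S v) + ∑ᴺ v (indicator ∘ S)) ≡⟨ ∑-closed-neighbourhood S ⟩
    suc n * ∑ (indicator ∘ S)                        ∎))
  where
  open ≤-Reasoning
  upper : ∀ v → indicator (D v) + ∑ᴺ v (indicator ∘ D) ≤ 1
  upper v with T? (D v)
  ... | yes v∈D = ≤-reflexive (cong₂ _+_ (T⇒indicator≡1 v∈D)
                    (∑ᴺ-none v (λ w vw → separated⇒independent sep v w vw v∈D)))
  ... | no  v∉D rewrite ¬T⇒indicator≡0 v∉D = ∑ᴺ-unique v (separated⇒unique sep v)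
  lower : ∀ v → 1 ≤ indicator (S v) + ∑ᴺ v (indicator ∘ S)
  lower v with T? (S v)
  ... | yes v∈S rewrite T⇒indicator≡1 v∈S = s≤s z≤n
  ... | no  v∉S = ≤-trans (≤-reflexive (sym (∑ᴺ≡1 v v∉S))) (m≤n+m _ _)

-- Connectivity

member? : (D : Subset (𝔽₂^ n)) → (∃[ v ] v ∈ˢ D) ⊎ (∀ v → v ∉ˢ D)
member? {zero} D with T? (D [])
... | yes []∈D = inj₁ ([] , []∈D)
... | no  []∉D = inj₂ λ { [] → []∉D }
member? {suc n} D with member? (D ∘ (false ∷_)) | member? (D ∘ (true ∷_))
... | inj₁ (v , v∈D) | _              = inj₁ (false ∷ v , v∈D)
... | inj₂ _         | inj₁ (v , v∈D) = inj₁ (true ∷ v , v∈D)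
... | inj₂ none₀     | inj₂ none₁     = inj₂ λ { (false ∷ v) → none₀ v ; (true ∷ v) → none₁ v }

AdjacentIn : Pred (𝔽₂^ n) _ → 𝔽₂^ n → 𝔽₂^ n → Set
AdjacentIn F u v = F u × F v × distance u v ≡ 1

ConnectedIn : Pred (𝔽₂^ n) _ → Set
ConnectedIn F = ∀ u v → F u → F v → Star (AdjacentIn F) u v

Avoids : (D X : Subset (𝔽₂^ n)) → Pred (𝔽₂^ n) _
Avoids D X v = v ∉ˢ D × v ∉ˢ X

-- Both ends are led into half `b`, joined there, and the second approach is run backwards.
connectedIn-halves : ∀ b {F : Pred (𝔽₂^ (suc n)) _} → ConnectedIn (F ∘ (b ∷_)) →
  (∀ v → F (not b ∷ v) → ∃[ w ] F (b ∷ w) × Star (AdjacentIn F) (not b ∷ v) (b ∷ w)) →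
  ConnectedIn F
connectedIn-halves b {F} conn retract u v Fu Fv =
  let u′ , Fu′ , u⟶ = reach u Fu
      v′ , Fv′ , v⟶ = reach v Fv
  in u⟶ ◅◅ Star.gmap (b ∷_) (λ { {x} {y} (Fx , Fy , xy) → Fx , Fy , adjacent-cons b x y xy })
              (conn u′ v′ Fu′ Fv′)
        ◅◅ Star.reverse (λ { {x} {y} (Fx , Fy , xy) → Fy , Fx , trans (distance-sym y x) xy }) v⟶
  where
  same-or-not : ∀ b c → c ≡ b ⊎ c ≡ not b
  same-or-not false false = inj₁ refl
  same-or-not false true  = inj₂ refl
  same-or-not true  false = inj₂ refl
  same-or-not true  true  = inj₁ refl
  reach : ∀ u → F u → ∃[ w ] F (b ∷ w) × Star (AdjacentIn F) u (b ∷ w)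
  reach (c ∷ u) Fu with same-or-not b c
  ... | inj₁ refl = u , Fu , ε
  ... | inj₂ refl = retract u Fu

-- Witness: the tail of a member of D, if there is one.
undominated : ∀ (D : Subset (𝔽₂^ (suc n))) → Separated D →
              ∃[ v ] ∀ c w → distance v w ≡ 1 → (c ∷ w) ∉ˢ D
undominated D sep with member? D
... | inj₂ none          = 𝟎 , λ c w _ → none (c ∷ w)
... | inj₁ (b ∷ v , v∈D) = v , λ c w vw w∈D → adjacent⇒≢ v w vw (∷-injectiveʳ
        (sep (b ∷ v) (c ∷ w) v∈D w∈D (s≤s (≤-trans (distance-∷≤ b c v w) (s≤s (≤-reflexive vw))))))

∑ᴺ<n⇒free : ∀ (v : 𝔽₂^ n) (X : Subset (𝔽₂^ n)) → ∑ (indicator ∘ X) < n →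
            ∃[ w ] distance v w ≡ 1 × w ∉ˢ X
∑ᴺ<n⇒free v X X<n with w , vw , 0≡ ← ∑ᴺ<n⇒zero v (indicator ∘ X) (≤-<-trans (∑ᴺ≤∑ v _) X<n)
  = w , vw , indicator≡0⇒¬T 0≡

-- `undominated` gives a `v` none of whose `n` neighbours has a copy in `D` in either half. As `X`
-- has fewer than `n` elements, some neighbour `w` keeps both copies, and the edge between them is a
-- bridge between the connected halves.
connected-light : ∀ (D X : Subset (𝔽₂^ (suc n))) → Separated D → ∑ (indicator ∘ X) < n →
  ConnectedIn (Avoids D X ∘ (true ∷_)) → ConnectedIn (Avoids D X ∘ (false ∷_)) →
  ConnectedIn (Avoids D X)
connected-light {n} D X sep X<n conn₁ conn₀ with v , v-free ← undominated D sep
  with w , vw , 0≡ ← ∑ᴺ<n⇒zero v (λ w → indicator (X (false ∷ w)) + indicator (X (true ∷ w)))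
         (≤-<-trans (∑ᴺ≤∑ v _) (subst (_< n) (sym (∑-+ {n} _ _)) X<n))
  = connectedIn-halves true conn₁ λ u Fu → w , w₁ ,
      Star.gmap (false ∷_) (λ z → z) (conn₀ u w Fu w₀) ◅◅ (w₀ , w₁ , adjacent-not∷ false w) ◅ ε
  where
  w₀ : Avoids D X (false ∷ w)
  w₀ = v-free false w vw , indicator≡0⇒¬T (m+n≡0⇒m≡0 _ 0≡)
  w₁ : Avoids D X (true ∷ w)
  w₁ = v-free true w vw , indicator≡0⇒¬T (m+n≡0⇒n≡0 _ 0≡)

-- A vertex crosses directly to the half without `X` unless its partner is a codeword. In that case
-- it first moves to a neighbour `w` outside `X`; both copies of `w` differ from that codeword and
-- are within distance 2 of it, hence not in `D`.
connected-heavy : ∀ b (D X : Subset (𝔽₂^ (suc n))) → Separated D →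
  ∑ (indicator ∘ X ∘ (not b ∷_)) < n → ∑ (indicator ∘ X ∘ (b ∷_)) ≡ 0 →
  ConnectedIn (Avoids D X ∘ (b ∷_)) → ConnectedIn (Avoids D X)
connected-heavy b D X sep X<n none conn = connectedIn-halves b conn cross
  where
  ∉X : ∀ w → (b ∷ w) ∉ˢ X
  ∉X w = indicator≡0⇒¬T (n≤0⇒n≡0 (≤-trans (≤∑ (indicator ∘ X ∘ (b ∷_)) w) (≤-reflexive none)))
  across : ∀ w → distance (not b ∷ w) (b ∷ w) ≡ 1
  across w = trans (distance-sym (not b ∷ w) (b ∷ w)) (adjacent-not∷ b w)
  cross : ∀ v → Avoids D X (not b ∷ v) →
          ∃[ w ] Avoids D X (b ∷ w) × Star (AdjacentIn (Avoids D X)) (not b ∷ v) (b ∷ w)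
  cross v (v∉D , v∉X) with T? (D (b ∷ v))
  ... | no  v′∉D = v , (v′∉D , ∉X v) , ((v∉D , v∉X) , (v′∉D , ∉X v) , across v) ◅ ε
  ... | yes v′∈D with w , vw , w∉X ← ∑ᴺ<n⇒free v (X ∘ (not b ∷_)) X<n
    = w , wᵇ , ((v∉D , v∉X) , w⁻ , adjacent-cons (not b) v w vw) ◅ (w⁻ , wᵇ , across w) ◅ ε
    where
    wᵇ : Avoids D X (b ∷ w)
    wᵇ = separated⇒independent sep (b ∷ v) (b ∷ w) (adjacent-cons b v w vw) v′∈D , ∉X w
    w⁻ : Avoids D X (not b ∷ w)
    w⁻ = (λ w∈D → adjacent⇒≢ v w vw (∷-injectiveʳ (sep (b ∷ v) (not b ∷ w) v′∈D w∈D
           (s≤s (≤-trans (distance-∷≤ b (not b) v w) (s≤s (≤-reflexive vw))))))) , w∉X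

-- A half with more than `m ∸ 1` elements of `X` has at least `m`, that is all of them, which leaves
-- none for the other half.
connected-step : ∀ (D X : Subset (𝔽₂^ (2 + m))) → Separated D → ∑ (indicator ∘ X) ≤ m →
  (∀ b → ∑ (indicator ∘ X ∘ (b ∷_)) ≤ m ∸ 1 → ConnectedIn (Avoids D X ∘ (b ∷_))) →
  ConnectedIn (Avoids D X)
connected-step {m} D X sep X≤m half = split (X# false ≤? m ∸ 1) (X# true ≤? m ∸ 1)
  where
  X# : Bool → ℕ
  X# b = ∑ (indicator ∘ X ∘ (b ∷_))
  heavy : ∀ b → ¬ X# (not b) ≤ m ∸ 1 → ConnectedIn (Avoids D X)
  heavy b X≰ = connected-heavy b D X sep (s≤s (≤-trans (∑-∷≤ (not b) (indicator ∘ X)) X≤m)) none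
                 (half b (≤-trans (≤-reflexive none) z≤n))
    where
    open ≤-Reasoning
    none : X# b ≡ 0
    none = n≤0⇒n≡0 (+-cancelʳ-≤ m (X# b) 0 (begin
      X# b + m          ≤⟨ +-monoʳ-≤ (X# b) (≤-trans (m≤n+m∸n m 1) (≰⇒> X≰)) ⟩
      X# b + X# (not b) ≡⟨ ∑-halves b (indicator ∘ X) ⟨
      ∑ (indicator ∘ X) ≤⟨ X≤m ⟩
      m                 ∎))
  split : Dec (X# false ≤ m ∸ 1) → Dec (X# true ≤ m ∸ 1) → ConnectedIn (Avoids D X)
  split (yes X₀) (yes X₁) = connected-light D X sep (s≤s X≤m) (half true X₁) (half false X₀)
  split (no  X₀) _        = heavy true X₀
  split (yes _)  (no X₁)  = heavy false X₁

-- Fewer than `n ∸ 1` deletions are at most `n ∸ 2`. In dimension `2 + m` this bound is `m`, and in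
-- the halves it is `m ∸ 1`, as `connected-step` requires.
separated⇒connected : ∀ (D X : Subset (𝔽₂^ n)) → Separated D → ∑ (indicator ∘ X) ≤ n ∸ 2 →
                      ConnectedIn (Avoids D X)
separated⇒connected {zero} D X sep _ [] [] Fu Fv = ε
separated⇒connected {suc zero} D X sep _ (false ∷ []) (false ∷ []) Fu Fv = ε
separated⇒connected {suc zero} D X sep _ (true  ∷ []) (true  ∷ []) Fu Fv = ε
separated⇒connected {suc zero} D X sep _ (false ∷ []) (true  ∷ []) Fu Fv = (Fu , Fv , refl) ◅ ε
separated⇒connected {suc zero} D X sep _ (true  ∷ []) (false ∷ []) Fu Fv = (Fu , Fv , refl) ◅ ε
separated⇒connected {suc (suc m)} D X sep X≤m = connected-step D X sep X≤m λ b →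
  separated⇒connected (D ∘ (b ∷_)) (X ∘ (b ∷_)) (separated-∷ b sep)

perfect⇒vertexConnected : ∀ n {D : Subset (𝔽₂^ n)} → 1 ≤ n → IsPerfectIndependentDominating (Q n) D →
                          VertexConnected (n ∸ 1) (Q n − D)
perfect⇒vertexConnected (suc n) {D} _ pid = n<order , connected
  where
  sep = perfect⇒separated pid
  n<order : n < order (Q (suc n) − D)
  -- The codeword `d` has `suc n` neighbours, and independence keeps all of them out of `D`.
  n<order with d , d∈D ← perfect⇒nonempty pid = begin
    suc n                                              ≡⟨ ∑ᴺ-complement D d ⟨
    ∑ᴺ d (indicator ∘ D) + ∑ᴺ d (indicator ∘ not ∘ D)
      ≡⟨ cong₂ _+_ (∑ᴺ-none d (λ v dv → separated⇒independent sep d v dv d∈D)) refl ⟩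
    ∑ᴺ d (indicator ∘ not ∘ D)                         ≤⟨ ∑ᴺ≤∑ d _ ⟩
    ∑ (indicator ∘ not ∘ D)                            ≡⟨ order-∑ D ⟨
    order (Q (suc n) − D)                              ∎
    where open ≤-Reasoning
  connected : ∀ X → card (Q (suc n) − D) X < n → Connected (Q (suc n) − D − X)
  connected X X<n {u} {v} u∈ v∈ = Star.map edge
    -- `X` may also contain vertices of `D`, which `card` does not count; only its part outside `D`
    -- obeys the bound.
    (separated⇒connected D (λ v → not (D v) ∧ X v) sep
      (<⇒≤pred (subst (_< n) (card-−-∑ D X) X<n)) u v (avoids u∈) (avoids v∈))
    where
    avoids : ∀ {v} → v ∈ vertices (Q (suc n) − D − X) → Avoids D (λ v → not (D v) ∧ X v) v
    avoids {v} v∈ with v∈′ , v∉X ← ∈-filter⁻ (λ v → ¬? (T? (X v))) {xs = vertices (Q (suc n) − D)} v∈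
      = vertex⇒∉ v∈′ , λ v∈ → v∉X (∧-T {not (D v)} v∈)
      where
      ∧-T : ∀ {a b} → T (a ∧ b) → T b
      ∧-T {true} t = t
    vertex : ∀ {v} → Avoids D (λ v → not (D v) ∧ X v) v → v ∈ vertices (Q (suc n) − D − X)
    vertex {v} (v∉D , v∉) = ∈-filter⁺ (λ v → ¬? (T? (X v))) (∉⇒vertex v v∉D) (∉-X v∉D v∉)
      where
      ∉-X : ∀ {a b} → ¬ T a → ¬ T (not a ∧ b) → ¬ T b
      ∉-X {false} _   ¬b = ¬b
      ∉-X {true}  ¬tt _  = contradiction _ ¬tt
    edge : ∀ {u v} → AdjacentIn (Avoids D (λ v → not (D v) ∧ X v)) u v → Edge (Q (suc n) − D − X) u v
    edge (Fu , Fv , uv) = vertex Fu , vertex Fv , uv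

-- Simple paths

infixr 5 _▹_▸_
data Walk (F : Pred (𝔽₂^ n) 0ℓ) : 𝔽₂^ n → 𝔽₂^ n → List (𝔽₂^ n) → Set where
  [_]   : ∀ {u} → F u → Walk F u u (u ∷ [])
  _▹_▸_ : ∀ {u v w p} → F u → distance u v ≡ 1 → Walk F v w p → Walk F u w (u ∷ p)

-- `l` counts vertices, both ends included.
Path : Pred (𝔽₂^ n) 0ℓ → 𝔽₂^ n → 𝔽₂^ n → ℕ → Set
Path F u v l = ∃[ p ] Walk F u v p × Unique p × length p ≡ l

-- The cube is bipartite, so a path joining adjacent vertices has an even number of vertices.
HasPaths : Pred (𝔽₂^ n) 0ℓ → ℕ → Set
HasPaths F a = ∀ u v → F u → F v → distance u v ≡ 1 → Path F u v (a + a)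

start∈ : ∀ {u v : 𝔽₂^ n} {p} → Walk F u v p → u ∈ p
start∈ [ _ ]       = here refl
start∈ (_ ▹ _ ▸ _) = here refl

walk-++ : ∀ {u v w x : 𝔽₂^ n} {p q} → Walk F u v p → distance v w ≡ 1 → Walk F w x q →
          Walk F u x (p ++ q)
walk-++ [ Fu ]          vw ws = Fu ▹ vw ▸ ws
walk-++ (Fu ▹ uv ▸ us) vw ws = Fu ▹ uv ▸ walk-++ us vw ws

Isometry : (𝔽₂^ m → 𝔽₂^ n) → Set
Isometry h = ∀ u v → distance (h u) (h v) ≡ distance u v

isometry-injective : (h : 𝔽₂^ m → 𝔽₂^ n) → Isometry h → ∀ {u v} → h u ≡ h v → u ≡ v
isometry-injective h iso {u} {v} eq = distance≡0⇒≡ u v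
  (trans (sym (iso u v)) (trans (cong (distance (h u)) (sym eq)) (distance-refl (h u))))

walk-map : {G : Pred (𝔽₂^ n) 0ℓ} (h : 𝔽₂^ m → 𝔽₂^ n) → Isometry h → (∀ v → F v → G (h v)) →
           ∀ {u v p} → Walk F u v p → Walk G (h u) (h v) (List.map h p)
walk-map h iso F⇒G [ Fu ]                        = [ F⇒G _ Fu ]
walk-map h iso F⇒G (_▹_▸_ {u} {v} Fu uv ws) =
  F⇒G _ Fu ▹ trans (iso u v) uv ▸ walk-map h iso F⇒G ws

path-map : {G : Pred (𝔽₂^ n) 0ℓ} (h : 𝔽₂^ m → 𝔽₂^ n) → Isometry h → (∀ v → F v → G (h v)) →
           ∀ {u v l} → Path F u v l → Path G (h u) (h v) l
path-map h iso F⇒G (p , walk , p! , |p|) =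
  List.map h p , walk-map h iso F⇒G walk ,
  Unique.map⁺ (isometry-injective h iso) p! , trans (List.length-map h p) |p|

hasPaths-resp : {F G : Pred (𝔽₂^ n) 0ℓ} → (∀ v → F v → G v) → (∀ v → G v → F v) →
                ∀ a → HasPaths F a → HasPaths G a
hasPaths-resp F⇒G G⇒F a paths u v Gu Gv uv with paths u v (G⇒F u Gu) (G⇒F v Gv) uv
... | p , walk , p! , |p| =
  p , subst (Walk _ u v) (List.map-id p) (walk-map (λ w → w) (λ _ _ → refl) F⇒G walk) , p! , |p|

hasPaths-1 : HasPaths F 1
hasPaths-1 u v Fu Fv uv =
  u ∷ v ∷ [] , Fu ▹ uv ▸ [ Fv ] , (adjacent⇒≢ u v uv ∷ []) ∷ [] ∷ [] , refl

-- Paths in the halves of a cube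

adjacent-≢∷ : ∀ {b c} → b ≢ c → (u : 𝔽₂^ n) → distance (b ∷ u) (c ∷ u) ≡ 1
adjacent-≢∷ {b = b} {c} b≢c u with refl ← ¬-not (b≢c ∘ sym) = adjacent-not∷ b u

disjoint-halves : ∀ {b c} → b ≢ c → ∀ {p q : List (𝔽₂^ n)} {v} →
                  ¬ (v ∈ List.map (b ∷_) p × v ∈ List.map (c ∷_) q)
disjoint-halves b≢c (v∈p , v∈q)
  with _ , _ , refl ← ∈-map⁻ _ v∈p | _ , _ , eq ← ∈-map⁻ _ v∈q = b≢c (∷-injectiveˡ eq)

module _ {b c : Bool} (b≢c : b ≢ c) {F : Pred (𝔽₂^ (suc n)) 0ℓ} where

  -- The lengthening step: the path in half `b` is cut between `x` and `y`, and the gap is filled by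
  -- crossing over, following a path in half `c` and crossing back.
  splice : ∀ {u v x y p₁ p₂ l} →
           Walk (F ∘ (b ∷_)) u x p₁ → Walk (F ∘ (b ∷_)) y v p₂ → Unique (p₁ ++ p₂) →
           Path (F ∘ (c ∷_)) x y l → Path F (b ∷ u) (b ∷ v) (length (p₁ ++ p₂) + l)
  splice {u} {v} {x} {y} {p₁} {p₂} {l} walk₁ walk₂ p! (q , walk , q! , |q|) =
    bp₁ ++ cq ++ bp₂ ,
    walk-++ (walk-map (b ∷_) (distance-∷ b) (λ _ Fw → Fw) walk₁) (adjacent-≢∷ b≢c x)
      (walk-++ (walk-map (c ∷_) (distance-∷ c) (λ _ Fw → Fw) walk) (adjacent-≢∷ (b≢c ∘ sym) y)
        (walk-map (b ∷_) (distance-∷ b) (λ _ Fw → Fw) walk₂)) ,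
    -- Distinctness ignores order. With the detour moved to the front, the rest is the image of
    -- `p₁ ++ p₂` in the other half.
    Unique-resp-↭ (setoid _) (↭⇒↭ₛ (↭-sym (shifts bp₁ cq)))
      (Unique.++⁺ (Unique.map⁺ ∷-injectiveʳ q!)
        (subst Unique (List.map-++ (b ∷_) p₁ p₂) (Unique.map⁺ ∷-injectiveʳ p!))
        (λ (∈cq , ∈bp) → disjoint-halves (b≢c ∘ sym)
           (∈cq , subst (_ ∈_) (sym (List.map-++ (b ∷_) p₁ p₂)) ∈bp))) ,
    (begin
      length (bp₁ ++ cq ++ bp₂)             ≡⟨ List.length-++ bp₁ ⟩
      length bp₁ + length (cq ++ bp₂)
        ≡⟨ cong (length bp₁ +_) (trans (List.length-++ cq) (+-comm (length cq) _)) ⟩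
      length bp₁ + (length bp₂ + length cq) ≡⟨ +-assoc (length bp₁) _ _ ⟨
      length bp₁ + length bp₂ + length cq
        ≡⟨ cong₂ _+_ (cong₂ _+_ (List.length-map _ p₁) (List.length-map _ p₂))
                     (trans (List.length-map _ q) |q|) ⟩
      length p₁ + length p₂ + l             ≡⟨ cong (_+ l) (List.length-++ p₁) ⟨
      length (p₁ ++ p₂) + l                 ∎)
    where
    open ≡-Reasoning
    bp₁ = List.map (b ∷_) p₁
    bp₂ = List.map (b ∷_) p₂
    cq  = List.map (c ∷_) q

  path-across : ∀ {u w v k l} → Path (F ∘ (b ∷_)) u w k → Path (F ∘ (c ∷_)) w v l →
                Path F (b ∷ u) (c ∷ v) (k + l)
  path-across {w = w} (p , walk₁ , p! , |p|) (q , walk₂ , q! , |q|) =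
    List.map (b ∷_) p ++ List.map (c ∷_) q ,
    walk-++ (walk-map (b ∷_) (distance-∷ b) (λ _ Fw → Fw) walk₁) (adjacent-≢∷ b≢c w)
            (walk-map (c ∷_) (distance-∷ c) (λ _ Fw → Fw) walk₂) ,
    Unique.++⁺ (Unique.map⁺ ∷-injectiveʳ p!) (Unique.map⁺ ∷-injectiveʳ q!)
      (disjoint-halves b≢c) ,
    trans (List.length-++ (List.map (b ∷_) p))
      (cong₂ _+_ (trans (List.length-map _ p) |p|) (trans (List.length-map _ q) |q|))

-- An edge `xy` of the path that admits a detour: `E` stands for the codewords of the other half, so
-- both `x` and `y` have a remaining copy there.
record GoodEdge (F : Pred (𝔽₂^ n) 0ℓ) (E : Subset (𝔽₂^ n)) (u v : 𝔽₂^ n) (p : List (𝔽₂^ n)) : Set where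
  constructor goodEdge
  field
    {x y}   : 𝔽₂^ n
    {p₁ p₂} : List (𝔽₂^ n)
    p≡      : p ≡ p₁ ++ p₂
    walk₁   : Walk F u x p₁
    xy      : distance x y ≡ 1
    walk₂   : Walk F y v p₂
    x∉E     : x ∉ˢ E
    y∉E     : y ∉ˢ E

-- Of three consecutive vertices at most one lies in a separated set, so one of
-- the first three edges of the path avoids it.
goodEdge-exists : ∀ {E : Subset (𝔽₂^ n)} {u v p} → Separated E → Walk F u v p → Unique p →
                  4 ≤ length p → GoodEdge F E u v p
goodEdge-exists sep [ _ ]                   _ (s≤s ())
goodEdge-exists sep (_ ▹ _ ▸ [ _ ])         _ (s≤s (s≤s ()))
goodEdge-exists sep (_ ▹ _ ▸ _ ▹ _ ▸ [ _ ]) _ (s≤s (s≤s (s≤s ())))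
goodEdge-exists {E = E} sep
  (_▹_▸_ {u₀} {u₁} F₀ u₀u₁ (_▹_▸_ {_} {u₂} F₁ u₁u₂ (_▹_▸_ {_} {u₃} F₂ u₂u₃ walk)))
  ((_ ∷ u₀≢u₂ ∷ _) ∷ (_ ∷ u₁≢) ∷ _) _ with T? (E u₁) | T? (E u₂)
... | yes u₁∈E | _ = goodEdge refl (F₀ ▹ u₀u₁ ▸ F₁ ▹ u₁u₂ ▸ [ F₂ ]) u₂u₃ walk
      (separated⇒independent sep u₁ u₂ u₁u₂ u₁∈E)
      (λ u₃∈E → All.lookup u₁≢ (start∈ walk)
        (separated⇒unique sep u₂ (trans (distance-sym u₂ u₁) u₁u₂) u₂u₃ u₁∈E u₃∈E))
... | no u₁∉E | no u₂∉E = goodEdge refl (F₀ ▹ u₀u₁ ▸ [ F₁ ]) u₁u₂ (F₂ ▹ u₂u₃ ▸ walk) u₁∉E u₂∉E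
... | no u₁∉E | yes u₂∈E = goodEdge refl [ F₀ ] u₀u₁ (F₁ ▹ u₁u₂ ▸ F₂ ▹ u₂u₃ ▸ walk)
      (λ u₀∈E → u₀≢u₂ (separated⇒unique sep u₁ (trans (distance-sym u₁ u₀) u₀u₁) u₁u₂ u₀∈E u₂∈E))
      u₁∉E

InHalf : Bool → Pred (𝔽₂^ (suc n)) 0ℓ → ℕ → Set
InHalf b F a = ∀ u v → F (b ∷ u) → F (b ∷ v) → distance u v ≡ 1 → Path F (b ∷ u) (b ∷ v) (a + a)

Across : Bool → Bool → Pred (𝔽₂^ (suc n)) 0ℓ → ℕ → Set
Across b c F a = ∀ u → F (b ∷ u) → F (c ∷ u) → Path F (b ∷ u) (c ∷ u) (a + a)

-- The halves are called `b` and `c` with `b ≢ c`, not `b` and `not b`, so that each construction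
-- applies again with the roles exchanged.
hasPaths-halves : ∀ {b c} → b ≢ c → {F : Pred (𝔽₂^ (suc n)) 0ℓ} → ∀ a →
  InHalf b F a → InHalf c F a → Across b c F a → Across c b F a → HasPaths F a
hasPaths-halves {b = b} {c} b≢c {F} a inb inc bc cb (d ∷ u) (e ∷ v) Fu Fv uv
  with cover d | cover e | adjacent-∷ d e u v uv
  where
  cover : ∀ d → d ≡ b ⊎ d ≡ c
  cover d with d ≟ᵇ b
  ... | yes d≡b = inj₁ d≡b
  ... | no  d≢b = inj₂ (trans (¬-not d≢b) (sym (¬-not (b≢c ∘ sym))))
... | inj₁ refl | _         | inj₁ (refl , uv′)  = inb u v Fu Fv uv′
... | inj₂ refl | _         | inj₁ (refl , uv′)  = inc u v Fu Fv uv′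
... | inj₁ refl | inj₂ refl | inj₂ (_ , refl)    = bc u Fu Fv
... | inj₂ refl | inj₁ refl | inj₂ (_ , refl)    = cb u Fu Fv
... | inj₁ refl | inj₁ refl | inj₂ (eq , _)      = contradiction eq (not-¬ refl)
... | inj₂ refl | inj₂ refl | inj₂ (eq , _)      = contradiction eq (not-¬ refl)

inHalf : ∀ {b} {F : Pred (𝔽₂^ (suc n)) 0ℓ} a → HasPaths (F ∘ (b ∷_)) a → InHalf b F a
inHalf {b = b} a paths u v Fu Fv uv = path-map (b ∷_) (distance-∷ b) (λ _ Fw → Fw) (paths u v Fu Fv uv)

module _ {b c : Bool} (b≢c : b ≢ c) {D : Subset (𝔽₂^ (suc n))} where

  -- A path on at least four vertices contains an edge whose copy in half `c` avoids `D`, and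
  -- `splice` replaces it by a path there.
  inHalf-detour : Separated D → ∀ a₀ a₁ → 2 ≤ a₀ →
    HasPaths ((_∉ˢ D) ∘ (b ∷_)) a₀ → HasPaths ((_∉ˢ D) ∘ (c ∷_)) a₁ → InHalf b (_∉ˢ D) (a₀ + a₁)
  inHalf-detour sep a₀ a₁ 2≤a₀ paths₀ paths₁ u v Fu Fv uv
    with p , walk , p! , |p| ← paths₀ u v Fu Fv uv
    with goodEdge {x} {y} refl walk₁ xy walk₂ x∉ y∉ ←
           goodEdge-exists (separated-∷ c sep) walk p!
             (≤-trans (+-mono-≤ 2≤a₀ 2≤a₀) (≤-reflexive (sym |p|)))
    = subst (Path _ _ _) (trans (cong (_+ (a₁ + a₁)) |p|) (+-interchange a₀ a₀ a₁ a₁))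
        (splice b≢c walk₁ walk₂ p! (paths₁ x y x∉ y∉ xy))

  -- With half `c` complete, the edge `uv` itself can take the detour. This supplies lengths that a
  -- 6-cycle in half `b` lacks.
  inHalf-bypass : ∀ {F : Pred (𝔽₂^ (suc n)) 0ℓ} a → (∀ v → F (c ∷ v)) →
    HasPaths (F ∘ (c ∷_)) a → InHalf b F (1 + a)
  inHalf-bypass {F} a full paths u v Fu Fv uv =
    subst (Path F _ _) (+-interchange 1 1 a a)
      (splice b≢c [ Fu ] [ Fv ] ((adjacent⇒≢ u v uv ∷ []) ∷ [] ∷ [])
        (paths u v (full u) (full v) uv))

  -- Each half of a separated set contains at most one of the n neighbours of u.
  across : Separated D → 3 ≤ n → ∀ a₀ a₁ →
    HasPaths ((_∉ˢ D) ∘ (b ∷_)) a₀ → HasPaths ((_∉ˢ D) ∘ (c ∷_)) a₁ →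
    Across b c (_∉ˢ D) (a₀ + a₁)
  across sep 3≤n a₀ a₁ paths₀ paths₁ u bu∉D cu∉D
    with w , uw , 0≡ ← ∑ᴺ<n⇒zero u (λ w → indicator (D (b ∷ w)) + indicator (D (c ∷ w)))
           (≤-trans (s≤s (≤-trans (≤-reflexive (∑ᴺ-+ u _ _))
             (+-mono-≤ (∑ᴺ-unique u (separated⇒unique (separated-∷ b sep) u))
                       (∑ᴺ-unique u (separated⇒unique (separated-∷ c sep) u))))) 3≤n)
    = subst (Path _ _ _) (+-interchange a₀ a₀ a₁ a₁)
        (path-across b≢c
          (paths₀ u w bu∉D (indicator≡0⇒¬T (m+n≡0⇒m≡0 _ 0≡)) uw)
          (paths₁ w u (indicator≡0⇒¬T (m+n≡0⇒n≡0 _ 0≡)) cu∉D (trans (distance-sym w u) uw)))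

-- Base cases

module _ {P : Pred (𝔽₂^ (suc n)) 0ℓ} where

  ∀-∷ : (∀ v → P (false ∷ v)) × (∀ v → P (true ∷ v)) → ∀ v → P v
  ∀-∷ (p₀ , p₁) (false ∷ v) = p₀ v
  ∀-∷ (p₀ , p₁) (true  ∷ v) = p₁ v

all-strings? : {P : Pred (𝔽₂^ n) 0ℓ} → Decidable P → Dec (∀ v → P v)
all-strings? {zero}  P? = map′ (λ { p [] → p }) (λ p → p []) (P? [])
all-strings? {suc n} P? = map′ ∀-∷ (λ p → p ∘ (false ∷_) , p ∘ (true ∷_))
  (all-strings? (P? ∘ (false ∷_)) ×-dec all-strings? (P? ∘ (true ∷_)))

infix 4 _≟ᵛ_
_≟ᵛ_ : (u v : 𝔽₂^ n) → Dec (u ≡ v)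
_≟ᵛ_ = ≡-dec _≟ᵇ_

walk? : Decidable F → ∀ u v p → Dec (Walk F u v p)
walk? F? u v []           = no λ ()
walk? F? u v (x ∷ [])     = map′ (λ { (refl , refl , Fu) → [ Fu ] }) (λ { [ Fu ] → refl , refl , Fu })
                              (u ≟ᵛ x ×-dec v ≟ᵛ x ×-dec F? x)
walk? F? u v (x ∷ y ∷ p)  = map′ (λ { (refl , Fu , uy , walk) → Fu ▹ uy ▸ walk }) uncons
                              (u ≟ᵛ x ×-dec F? x ×-dec (distance x y ≟ 1) ×-dec walk? F? y v (y ∷ p))
  where
  uncons : ∀ {u v x y p} → Walk F u v (x ∷ y ∷ p) →
           u ≡ x × F x × distance x y ≡ 1 × Walk F y v (y ∷ p)
  uncons (Fu ▹ uy ▸ walk@([ _ ]))     = refl , Fu , uy , walk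
  uncons (Fu ▹ uy ▸ walk@(_ ▹ _ ▸ _)) = refl , Fu , uy , walk

module _ {F : Pred (𝔽₂^ n) 0ℓ} (F? : Decidable F) (steps : List (List (𝔽₂^ n))) (a : ℕ) where

  -- A candidate path is stored as its sequence of steps; `scanl _⊕_ u` starts it at `u`, so a few
  -- sequences serve all edges.
  HasPathsVia : Set
  HasPathsVia = ∀ u v → F u → F v → distance u v ≡ 1 →
    Any (λ es → Walk F u v (scanl _⊕_ u es) × Unique (scanl _⊕_ u es) ×
                length (scanl _⊕_ u es) ≡ a + a) steps

  hasPathsVia? : Dec HasPathsVia
  hasPathsVia? = all-strings? λ u → all-strings? λ v → F? u →-dec F? v →-dec (distance u v ≟ 1) →-dec
    Any.any? (λ es → walk? F? u v (scanl _⊕_ u es) ×-dec DecUnique.unique? _≟ᵛ_ (scanl _⊕_ u es) ×-dec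
                     (length (scanl _⊕_ u es) ≟ a + a)) steps

  hasPathsVia⇒hasPaths : HasPathsVia → HasPaths F a
  hasPathsVia⇒hasPaths via u v Fu Fv uv with es , valid ← Any.satisfied (via u v Fu Fv uv)
    = scanl _⊕_ u es , valid

-- The entries j, k of w i j k are the two directions other than i, and w i j k
-- lists the steps of a path from u to u ⊕ i.
eachDirection : (𝔽₂^ 3 → 𝔽₂^ 3 → 𝔽₂^ 3 → List (𝔽₂^ 3)) → List (List (𝔽₂^ 3))
eachDirection w = w e₀ e₁ e₂ ∷ w e₀ e₂ e₁ ∷ w e₁ e₀ e₂ ∷ w e₁ e₂ e₀ ∷ w e₂ e₀ e₁ ∷ w e₂ e₁ e₀ ∷ []
  where
  e₀ = true  ∷ false ∷ false ∷ []
  e₁ = false ∷ true  ∷ false ∷ []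
  e₂ = false ∷ false ∷ true  ∷ []

-- In `hexagons` the directions recur with period three, so the path consists of five edges of a
-- 6-cycle that misses an antipodal pair. The words in `octagons` are reflected Gray codes, that is,
-- Hamiltonian paths of Q₃.
squares hexagons octagons : List (List (𝔽₂^ 3))
squares  = eachDirection λ i j k → j ∷ i ∷ j ∷ []
hexagons = eachDirection λ i j k → k ∷ j ∷ i ∷ k ∷ j ∷ []
octagons = eachDirection λ i j k → k ∷ j ∷ k ∷ i ∷ k ∷ j ∷ k ∷ []

-- Antipodal pairs in Q₃

antipode : 𝔽₂^ 3 → 𝔽₂^ 3
antipode = _⊕ (true ∷ true ∷ true ∷ [])

-- A 6-cycle: this is what remains of Q₃ when `D` is nonempty, separated and invariant under 111.
OffPair : 𝔽₂^ 3 → Pred (𝔽₂^ 3) 0ℓ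
OffPair d v = v ≢ d × v ≢ antipode d

offPair? : ∀ d → Decidable (OffPair d)
offPair? d v = ¬? (v ≟ᵛ d) ×-dec ¬? (v ≟ᵛ antipode d)

offPair-hasPaths-3 : ∀ d → HasPaths (OffPair d) 3
offPair-hasPaths-3 d = hasPathsVia⇒hasPaths (offPair? d) hexagons 3
  (from-yes (all-strings? λ d → hasPathsVia? (offPair? d) hexagons 3) d)

-- On a 6-cycle, two adjacent vertices are joined by their edge and by the way round, and by no
-- other path; hence `a = 2` is missing.
offPair-hasPaths : ∀ d a → a ≡ 1 ⊎ a ≡ 3 → HasPaths (OffPair d) a
offPair-hasPaths d _ (inj₁ refl) = hasPaths-1
offPair-hasPaths d _ (inj₂ refl) = offPair-hasPaths-3 d

cube-hasPaths : ∀ a → 1 ≤ a → a ≤ 4 → HasPaths {3} (λ _ → ⊤) a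
cube-hasPaths 1 _ _ = hasPaths-1
cube-hasPaths 2 _ _ = hasPathsVia⇒hasPaths (λ _ → yes tt) squares 2
  (from-yes (hasPathsVia? (λ _ → yes tt) squares 2))
cube-hasPaths 3 _ _ = hasPathsVia⇒hasPaths (λ _ → yes tt) hexagons 3
  (from-yes (hasPathsVia? (λ _ → yes tt) hexagons 3))
cube-hasPaths 4 _ _ = hasPathsVia⇒hasPaths (λ _ → yes tt) octagons 4
  (from-yes (hasPathsVia? (λ _ → yes tt) octagons 4))
cube-hasPaths (suc (suc (suc (suc (suc _))))) _ (s≤s (s≤s (s≤s (s≤s ()))))

weight≡3⇒ones : (u : 𝔽₂^ 3) → distance 𝟎 u ≡ 3 → u ≡ true ∷ true ∷ true ∷ []
weight≡3⇒ones = from-yes (all-strings? λ u → (distance 𝟎 u ≟ 3) →-dec (u ≟ᵛ true ∷ true ∷ true ∷ []))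

-- An antipodal pair is a perfect code of Q₃. A separated set that contains one therefore has no
-- other element in this Q₃, and none in an adjacent copy.
near-pair : (d v : 𝔽₂^ 3) → distance d v ≤ 1 ⊎ distance (antipode d) v ≤ 1
near-pair = from-yes (all-strings? λ d → all-strings? λ v →
  (distance d v ≤? 1) ⊎-dec (distance (antipode d) v ≤? 1))

offPair-order : ∀ d → ∑ (λ v → indicator (does (offPair? d v))) ≡ 6
offPair-order = from-yes (all-strings? λ d → ∑ (λ v → indicator (does (offPair? d v))) ≟ 6)

Invariant : 𝔽₂^ n → Subset (𝔽₂^ n) → Set
Invariant u D = ∀ v → v ∈ˢ D → (v ⊕ u) ∈ˢ D

module _ {D : Subset (𝔽₂^ 3)} (sep : Separated D) (inv : Invariant (true ∷ true ∷ true ∷ []) D)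
         {d : 𝔽₂^ 3} (d∈D : d ∈ˢ D) where

  ∉⇒offPair : ∀ v → v ∉ˢ D → OffPair d v
  ∉⇒offPair v v∉D = (λ { refl → v∉D d∈D }) , (λ { refl → v∉D (inv d d∈D) })

  offPair⇒∉ : ∀ v → OffPair d v → v ∉ˢ D
  offPair⇒∉ v (v≢d , v≢d̄) v∈D with near-pair d v
  ... | inj₁ dv≤1 = v≢d (sym (sep d v d∈D v∈D (s≤s (m≤n⇒m≤1+n dv≤1))))
  ... | inj₂ dv≤1 = v≢d̄ (sym (sep (antipode d) v (inv d d∈D) v∈D (s≤s (m≤n⇒m≤1+n dv≤1))))

  order-pair : ∑ (indicator ∘ not ∘ D) ≤ 6
  order-pair = ≤-trans (∑-mono le) (≤-reflexive (offPair-order d))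
    where
    le : ∀ v → indicator (not (D v)) ≤ indicator (does (offPair? d v))
    le v with T? (D v)
    ... | yes v∈D = ≤-trans (≤-reflexive (T⇒indicator-not≡0 v∈D)) z≤n
    ... | no  v∉D rewrite dec-true (offPair? d v) (∉⇒offPair v v∉D) = indicator≤1 _

  pair-hasPaths : ∀ a → a ≡ 1 ⊎ a ≡ 3 → HasPaths (_∉ˢ D) a
  pair-hasPaths a a≡ = hasPaths-resp offPair⇒∉ ∉⇒offPair a (offPair-hasPaths d a a≡)

empty-hasPaths : {D : Subset (𝔽₂^ 3)} → (∀ v → v ∉ˢ D) → ∀ a → 1 ≤ a → a ≤ 4 → HasPaths (_∉ˢ D) a
empty-hasPaths none a 1≤a a≤4 = hasPaths-resp (λ v _ → none v) _ a (cube-hasPaths a 1≤a a≤4)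

-- Bipancyclicity

-- The order enters only through the bound `half + half`, so that the values for the two halves of a
-- cube simply add up. By `2≤half` the longest paths have the four vertices that a detour requires.
record Bipancyclic (D : Subset (𝔽₂^ n)) : Set where
  field
    half   : ℕ
    2≤half : 2 ≤ half
    order≤ : ∑ (indicator ∘ not ∘ D) ≤ half + half
    paths  : ∀ a → 1 ≤ a → a ≤ half → HasPaths (_∉ˢ D) a

open Bipancyclic

module _ {D : Subset (𝔽₂^ (suc n))} (sep : Separated D) (3≤n : 3 ≤ n)
         {b c : Bool} (b≢c : b ≢ c)
         (Bᵇ : Bipancyclic (D ∘ (b ∷_))) (Bᶜ : Bipancyclic (D ∘ (c ∷_))) where

  -- Lengths beyond the reach of half `b` arise from a longest path there by a detour that covers
  -- the rest.
  bipancyclic-inHalf : ∀ a → 1 ≤ a → a ≤ half Bᵇ + half Bᶜ → InHalf b (_∉ˢ D) a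
  bipancyclic-inHalf a 1≤a a≤ with a ≤? half Bᵇ
  ... | yes a≤h = inHalf a (paths Bᵇ a 1≤a a≤h)
  ... | no  a≰h = subst (InHalf b (_∉ˢ D)) (m+[n∸m]≡n (≰⇒≥ a≰h))
    (inHalf-detour b≢c sep (half Bᵇ) (a ∸ half Bᵇ) (2≤half Bᵇ)
      (paths Bᵇ (half Bᵇ) (≤-trans (n≤1+n 1) (2≤half Bᵇ)) ≤-refl)
      (paths Bᶜ (a ∸ half Bᵇ) (m<n⇒0<n∸m (≰⇒> a≰h)) (m≤n+o⇒m∸n≤o a (half Bᵇ) a≤)))

  -- The `a` pairs of vertices are divided so that each half receives at least one: if all but one
  -- fit into half `b`, the last goes to `c`; otherwise half `b` gets its maximum.
  bipancyclic-across : ∀ a → 1 ≤ a → a ≤ half Bᵇ + half Bᶜ → Across b c (_∉ˢ D) a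
  bipancyclic-across 1 _ _ u bu∉D cu∉D =
    hasPaths-1 (b ∷ u) (c ∷ u) bu∉D cu∉D (adjacent-≢∷ b≢c u)
  bipancyclic-across (suc a@(suc _)) _ a≤ with a ≤? half Bᵇ
  ... | yes a≤h = subst (Across b c (_∉ˢ D)) (+-comm a 1)
    (across b≢c sep 3≤n a 1 (paths Bᵇ a (s≤s z≤n) a≤h)
      (paths Bᶜ 1 ≤-refl (≤-trans (n≤1+n 1) (2≤half Bᶜ))))
  ... | no  a≰h = subst (Across b c (_∉ˢ D)) (m+[n∸m]≡n (≤-trans (≰⇒≥ a≰h) (n≤1+n a)))
    (across b≢c sep 3≤n (half Bᵇ) (suc a ∸ half Bᵇ)
      (paths Bᵇ (half Bᵇ) (≤-trans (n≤1+n 1) (2≤half Bᵇ)) ≤-refl)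
      (paths Bᶜ (suc a ∸ half Bᵇ) (m<n⇒0<n∸m (≤-trans (≰⇒> a≰h) (n≤1+n a)))
        (m≤n+o⇒m∸n≤o (suc a) (half Bᵇ) a≤)))

bipancyclic-∷ : {D : Subset (𝔽₂^ (suc n))} → Separated D → 3 ≤ n →
  Bipancyclic (D ∘ (false ∷_)) → Bipancyclic (D ∘ (true ∷_)) → Bipancyclic D
bipancyclic-∷ sep 3≤n B₀ B₁ = record
  { half   = half B₀ + half B₁
  ; 2≤half = ≤-trans (2≤half B₀) (m≤m+n _ _)
  ; order≤ = ≤-trans (+-mono-≤ (order≤ B₀) (order≤ B₁))
               (≤-reflexive (+-interchange (half B₀) (half B₀) (half B₁) (half B₁)))
  ; paths  = λ a 1≤a a≤ → hasPaths-halves {b = false} {true} (λ ()) a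
      (bipancyclic-inHalf sep 3≤n (λ ()) B₀ B₁ a 1≤a a≤)
      (bipancyclic-inHalf sep 3≤n (λ ()) B₁ B₀ a 1≤a (≤-trans a≤ (swap≤)))
      (bipancyclic-across sep 3≤n (λ ()) B₀ B₁ a 1≤a a≤)
      (bipancyclic-across sep 3≤n (λ ()) B₁ B₀ a 1≤a (≤-trans a≤ (swap≤)))
  }
  where
  swap≤ : half B₀ + half B₁ ≤ half B₁ + half B₀
  swap≤ = ≤-reflexive (+-comm (half B₀) _)

order≤8 : (D : Subset (𝔽₂^ 3)) → ∑ (indicator ∘ not ∘ D) ≤ 8
order≤8 D = ∑-mono {3} {g = λ _ → 1} (λ v → indicator≤1 (not (D v)))

empty-bipancyclic : {D : Subset (𝔽₂^ 3)} → (∀ v → v ∉ˢ D) → Bipancyclic D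
empty-bipancyclic {D} none = record
  { half = 4 ; 2≤half = s≤s (s≤s z≤n) ; order≤ = order≤8 D ; paths = empty-hasPaths none }

module _ {b c : Bool} (b≢c : b ≢ c) {D : Subset (𝔽₂^ 4)} (sep : Separated D)
         (inv : Invariant (true ∷ true ∷ true ∷ []) (D ∘ (b ∷_)))
         {d : 𝔽₂^ 3} (d∈D : (b ∷ d) ∈ˢ D) where

  -- By `near-pair` every vertex of half `c` is within distance 2 of one of the two codewords in
  -- half `b`.
  pair-opposite-empty : ∀ v → (c ∷ v) ∉ˢ D
  pair-opposite-empty v v∈D with near-pair d v
  ... | inj₁ ≤1 = b≢c (∷-injectiveˡ (sep (b ∷ d) (c ∷ v) d∈D v∈D
                    (s≤s (≤-trans (distance-∷≤ b c d v) (s≤s ≤1)))))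
  ... | inj₂ ≤1 = b≢c (∷-injectiveˡ (sep (b ∷ antipode d) (c ∷ v) (inv d d∈D) v∈D
                    (s≤s (≤-trans (distance-∷≤ b c (antipode d) v) (s≤s ≤1)))))

  private
    c≢b : c ≢ b
    c≢b = b≢c ∘ sym

    pair₁ = pair-hasPaths (separated-∷ b sep) inv d∈D 1 (inj₁ refl)
    pair₃ = pair-hasPaths (separated-∷ b sep) inv d∈D 3 (inj₂ refl)

    empty₁ = empty-hasPaths pair-opposite-empty 1 (s≤s z≤n) (s≤s z≤n)
    empty₂ = empty-hasPaths pair-opposite-empty 2 (s≤s z≤n) (s≤s (s≤s z≤n))
    empty₃ = empty-hasPaths pair-opposite-empty 3 (s≤s z≤n) (s≤s (s≤s (s≤s z≤n)))
    empty₄ = empty-hasPaths pair-opposite-empty 4 (s≤s z≤n) (s≤s (s≤s (s≤s (s≤s z≤n))))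

    2≤2+ : ∀ {a} → 2 ≤ 2 + a
    2≤2+ = s≤s (s≤s z≤n)

    -- For edges across, `a` is split into 1 or 3 from the 6-cycle in half `b` and 1 to 4 from the
    -- full half `c`, up to 7 = 3 + 4. Inside half `b` the values 2, 4 and 5 come from a bypass.
    hasPaths-7 : ∀ a → 1 ≤ a → a ≤ 7 → HasPaths (_∉ˢ D) a
    hasPaths-7 1 _ _ = hasPaths-1
    hasPaths-7 2 _ _ = hasPaths-halves b≢c 2
      (inHalf-bypass b≢c {D} 1 pair-opposite-empty empty₁) (inHalf 2 empty₂)
      (across b≢c sep ≤-refl 1 1 pair₁ empty₁) (across c≢b sep ≤-refl 1 1 empty₁ pair₁)
    hasPaths-7 3 _ _ = hasPaths-halves b≢c 3
      (inHalf 3 pair₃) (inHalf 3 empty₃)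
      (across b≢c sep ≤-refl 1 2 pair₁ empty₂) (across c≢b sep ≤-refl 2 1 empty₂ pair₁)
    hasPaths-7 4 _ _ = hasPaths-halves b≢c 4
      (inHalf-bypass b≢c {D} 3 pair-opposite-empty empty₃) (inHalf 4 empty₄)
      (across b≢c sep ≤-refl 1 3 pair₁ empty₃) (across c≢b sep ≤-refl 3 1 empty₃ pair₁)
    hasPaths-7 5 _ _ = hasPaths-halves b≢c 5
      (inHalf-bypass b≢c {D} 4 pair-opposite-empty empty₄) (inHalf-detour c≢b sep 4 1 2≤2+ empty₄ pair₁)
      (across b≢c sep ≤-refl 1 4 pair₁ empty₄) (across c≢b sep ≤-refl 4 1 empty₄ pair₁)
    hasPaths-7 6 _ _ = hasPaths-halves b≢c 6
      (inHalf-detour b≢c sep 3 3 2≤2+ pair₃ empty₃) (inHalf-detour c≢b sep 3 3 2≤2+ empty₃ pair₃)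
      (across b≢c sep ≤-refl 3 3 pair₃ empty₃) (across c≢b sep ≤-refl 3 3 empty₃ pair₃)
    hasPaths-7 7 _ _ = hasPaths-halves b≢c 7
      (inHalf-detour b≢c sep 3 4 2≤2+ pair₃ empty₄) (inHalf-detour c≢b sep 4 3 2≤2+ empty₄ pair₃)
      (across b≢c sep ≤-refl 3 4 pair₃ empty₄) (across c≢b sep ≤-refl 4 3 empty₄ pair₃)
    hasPaths-7 (suc (suc (suc (suc (suc (suc (suc (suc _)))))))) _
      (s≤s (s≤s (s≤s (s≤s (s≤s (s≤s (s≤s ())))))))

  pair-bipancyclic : Bipancyclic D
  pair-bipancyclic = record
    { half   = 7
    ; 2≤half = s≤s (s≤s z≤n)
    ; order≤ = begin
        ∑ (indicator ∘ not ∘ D)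
          ≡⟨ ∑-halves b (indicator ∘ not ∘ D) ⟩
        ∑ (indicator ∘ not ∘ D ∘ (b ∷_)) + ∑ (indicator ∘ not ∘ D ∘ (not b ∷_))
          ≤⟨ +-mono-≤ (order-pair (separated-∷ b sep) inv d∈D) (order≤8 (D ∘ (not b ∷_))) ⟩
        14 ∎
    ; paths  = hasPaths-7
    }
    where open ≤-Reasoning

-- A codeword in one half clears the other by `pair-opposite-empty`; without codewords the general
-- step applies to two full copies of Q₃.
bipancyclic-4 : {D : Subset (𝔽₂^ 4)} → Separated D →
  (∀ b → Invariant (true ∷ true ∷ true ∷ []) (D ∘ (b ∷_))) → Bipancyclic D
bipancyclic-4 {D} sep inv with member? (D ∘ (false ∷_)) | member? (D ∘ (true ∷_))
... | inj₁ (_ , d∈D) | _              = pair-bipancyclic {false} {true} (λ ()) sep (inv false) d∈D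
... | inj₂ _         | inj₁ (_ , d∈D) = pair-bipancyclic {true} {false} (λ ()) sep (inv true) d∈D
... | inj₂ none₀     | inj₂ none₁     =
  bipancyclic-∷ sep ≤-refl (empty-bipancyclic none₀) (empty-bipancyclic none₁)

-- Choosing the coordinate along which the cube is halved

-- A permutation of coordinates that turns halving along the first coordinate into halving along
-- coordinate `i`.
moveHeadTo : Fin (suc n) → 𝔽₂^ (suc n) → 𝔽₂^ (suc n)
moveHeadTo i (b ∷ v) = insertAt v i b

distance-insertAt : ∀ (i : Fin (suc n)) b c (u v : 𝔽₂^ n) →
  distance (insertAt u i b) (insertAt v i c) ≡ distance (b ∷ u) (c ∷ v)
distance-insertAt zero b c u v = refl
distance-insertAt (suc i) b c (x ∷ u) (y ∷ v) = trans
  (cong (if not (does (x ≟ᵇ y)) then suc else id) (distance-insertAt i b c u v)) swap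
  where
  swap : distance (x ∷ b ∷ u) (y ∷ c ∷ v) ≡ distance (b ∷ x ∷ u) (c ∷ y ∷ v)
  swap with does (x ≟ᵇ y) | does (b ≟ᵇ c)
  ... | false | false = refl
  ... | false | true  = refl
  ... | true  | false = refl
  ... | true  | true  = refl

moveHeadTo-isometry : ∀ (i : Fin (suc n)) → Isometry (moveHeadTo i)
moveHeadTo-isometry i (b ∷ u) (c ∷ v) = distance-insertAt i b c u v

∑-moveHeadTo : ∀ (i : Fin (suc n)) f → ∑ (f ∘ moveHeadTo i) ≡ ∑ f
∑-moveHeadTo zero    f = refl
∑-moveHeadTo {suc n} (suc i) f = trans
  (+-interchange (∑ (λ v → f (false ∷ insertAt v i false))) _ _ _)
  (cong₂ _+_ (∑-moveHeadTo i (f ∘ (false ∷_))) (∑-moveHeadTo i (f ∘ (true ∷_))))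

insertAt-⊕ : ∀ (i : Fin (suc n)) b c (u v : 𝔽₂^ n) →
             insertAt u i b ⊕ insertAt v i c ≡ insertAt (u ⊕ v) i (b xor c)
insertAt-⊕ zero    b c u       v       = refl
insertAt-⊕ (suc i) b c (x ∷ u) (y ∷ v) = cong ((x xor y) ∷_) (insertAt-⊕ i b c u v)

insertAt-𝟎 : ∀ (i : Fin (suc n)) → insertAt 𝟎 i false ≡ 𝟎
insertAt-𝟎         zero    = refl
insertAt-𝟎 {suc n} (suc i) = cong (false ∷_) (insertAt-𝟎 i)

-- A weight below the length leaves a zero coordinate, and the first one is taken.
light⇒insertAt : ∀ (u : 𝔽₂^ (suc n)) → distance 𝟎 u ≤ n →
                 ∃[ i ] ∃[ u′ ] insertAt u′ i false ≡ u
light⇒insertAt         (false ∷ u) _         = zero , u , refl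
light⇒insertAt {suc n} (true  ∷ u) (s≤s u≤n) with i , u′ , eq ← light⇒insertAt u u≤n
  = suc i , true ∷ u′ , cong (true ∷_) eq

bipancyclic-moveHeadTo : ∀ (i : Fin (suc n)) {D : Subset (𝔽₂^ (suc n))} →
                         Bipancyclic (D ∘ moveHeadTo i) → Bipancyclic D
bipancyclic-moveHeadTo i {D} B = record
  { half   = half B
  ; 2≤half = 2≤half B
  ; order≤ = ≤-trans (≤-reflexive (sym (∑-moveHeadTo i (indicator ∘ not ∘ D)))) (order≤ B)
  ; paths  = λ a 1≤a a≤h u v u∉D v∉D uv →
      subst₂ (λ u v → Path (_∉ˢ D) u v (a + a)) (to∘from u) (to∘from v)
        (path-map to (moveHeadTo-isometry i) (λ _ w∉D → w∉D)
          (paths B a 1≤a a≤h (from u) (from v)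
            (subst (_∉ˢ D) (sym (to∘from u)) u∉D) (subst (_∉ˢ D) (sym (to∘from v)) v∉D)
            (trans (sym (moveHeadTo-isometry i (from u) (from v)))
              (trans (cong₂ distance (to∘from u) (to∘from v)) uv))))
  }
  where
  to = moveHeadTo i
  from : 𝔽₂^ _ → 𝔽₂^ _
  from v = lookup v i ∷ removeAt v i
  to∘from : ∀ v → to (from v) ≡ v
  to∘from v = insertAt-removeAt v i

-- The cube is halved along a coordinate where `u` is 0, so translation by `u` preserves both halves
-- and acts there as `u′`, still of weight 3. The descent ends in Q₄, where the halves are Q₃ and
-- `u′` is 111.
bipancyclic : ∀ m {D : Subset (𝔽₂^ (4 + m))} u → distance 𝟎 u ≡ 3 →
              Separated D → Invariant u D → Bipancyclic D
bipancyclic m {D} u |u|≡3 sep inv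
  with i , u′ , refl ← light⇒insertAt u (≤-trans (≤-reflexive |u|≡3) (m≤m+n 3 m))
  = bipancyclic-moveHeadTo i (halved m sep′ inv′ |u′|≡3)
  where
  |u′|≡3 : distance 𝟎 u′ ≡ 3
  |u′|≡3 = trans (sym (distance-insertAt i false false 𝟎 u′))
    (trans (cong (λ z → distance z (insertAt u′ i false)) (insertAt-𝟎 i)) |u|≡3)
  sep′ : Separated (D ∘ moveHeadTo i)
  sep′ v w v∈D w∈D vw<3 = isometry-injective (moveHeadTo i) (moveHeadTo-isometry i)
    (sep _ _ v∈D w∈D (subst (_< 3) (sym (moveHeadTo-isometry i v w)) vw<3))
  inv′ : ∀ b → Invariant u′ (D ∘ moveHeadTo i ∘ (b ∷_))
  inv′ b v v∈D = subst (_∈ˢ D) (trans (insertAt-⊕ i b false v u′)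
    (cong (insertAt (v ⊕ u′) i) (xor-identityʳ b))) (inv _ v∈D)
  halved : ∀ m {u} {D : Subset (𝔽₂^ (4 + m))} → Separated D →
           (∀ b → Invariant u (D ∘ (b ∷_))) → distance 𝟎 u ≡ 3 → Bipancyclic D
  halved zero    {u} sep inv |u|≡3 with refl ← weight≡3⇒ones u |u|≡3 = bipancyclic-4 sep inv
  halved (suc m) {u} sep inv |u|≡3 = bipancyclic-∷ sep (m≤m+n 3 (suc m))
    (bipancyclic m u |u|≡3 (separated-∷ false sep) (inv false))
    (bipancyclic m u |u|≡3 (separated-∷ true sep) (inv true))

-- Cycles

-- `cyclicPairs` closes up at the head of the list; the induction needs a closing vertex `t` that
-- stays fixed while the head moves on.
walk-closes : ∀ {D : Subset (𝔽₂^ n)} {u v t x xs} → Walk (_∉ˢ D) u v (x ∷ xs) → t ∉ˢ D →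
              distance v t ≡ 1 →
              All (uncurry (Edge (Q n − D))) (List.zip (x ∷ xs) (xs ∷ʳ t)) ×
              (v , t) ∈ List.zip (x ∷ xs) (xs ∷ʳ t)
walk-closes {u = u} {t = t} [ u∉D ] t∉D ut = (∉⇒vertex u u∉D , ∉⇒vertex t t∉D , ut) ∷ [] , here refl
-- Matching on the rest of the walk exposes the head of its list, so that `List.zip` computes.
walk-closes {u = u} (u∉D ▹ uw ▸ walk@([_] {w} w∉D)) t∉D vt =
  let edges , vt∈ = walk-closes walk t∉D vt
  in (∉⇒vertex u u∉D , ∉⇒vertex w w∉D , uw) ∷ edges , there vt∈
walk-closes {u = u} (u∉D ▹ uw ▸ walk@(_▹_▸_ {w} w∉D _ _)) t∉D vt =
  let edges , vt∈ = walk-closes walk t∉D vt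
  in (∉⇒vertex u u∉D , ∉⇒vertex w w∉D , uw) ∷ edges , there vt∈

walk⇒cycle : ∀ {D : Subset (𝔽₂^ n)} {u v c} → Walk (_∉ˢ D) u v c → Unique c → 3 ≤ length c →
             distance v u ≡ 1 → IsCycle (Q n − D) c × (v , u) ∈ cyclicPairs c
walk⇒cycle walk@([ u∉D ]) c! 3≤ vu = let edges , vu∈ = walk-closes walk u∉D vu in
  record { length≥3 = 3≤ ; distinct = c! ; edges = edges } , vu∈
walk⇒cycle walk@(u∉D ▹ _ ▸ _) c! 3≤ vu = let edges , vu∈ = walk-closes walk u∉D vu in
  record { length≥3 = 3≤ ; distinct = c! ; edges = edges } , vu∈

m+m≡m*2 : ∀ m → m + m ≡ m * 2
m+m≡m*2 m = trans (cong (m +_) (sym (+-identityʳ m))) (*-comm 2 m)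

bipancyclic⇒edgeBipancyclic : {D : Subset (𝔽₂^ n)} → Bipancyclic D → EdgeBipancyclic (Q n − D)
bipancyclic⇒edgeBipancyclic {D = D} B {u} {v} (u∈ , v∈ , uv) l (divides a refl) 4≤l l≤order
  with c , walk , c! , |c| ← paths B a
         (*-cancelʳ-≤ 1 a 2 (≤-trans (s≤s (s≤s z≤n)) 4≤l))
         (*-cancelʳ-≤ a (half B) 2
           (≤-trans l≤order (≤-trans (≤-reflexive (order-∑ D))
             (≤-trans (order≤ B) (≤-reflexive (m+m≡m*2 (half B)))))))
         u v (vertex⇒∉ u∈) (vertex⇒∉ v∈) uv
  with |c|≡l ← trans |c| (m+m≡m*2 a)
  with cycle , vu∈ ← walk⇒cycle walk c! (≤-trans (n≤1+n 3) (≤-trans 4≤l (≤-reflexive (sym |c|≡l))))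
         (trans (distance-sym v u) uv)
  -- The path runs from `u` to `v`, so the closing edge leads from `v` back to `u`.
  = c , cycle , |c|≡l , inj₂ vu∈

-- Seen from `d`, the vertices alternate between weights 1 and 2; weights 0 and 3 belong to `d` and
-- its antipode.
hexagonAround : 𝔽₂^ 3 → List (𝔽₂^ 3)
hexagonAround d = List.map (d ⊕_)
  ( (true  ∷ false ∷ false ∷ []) ∷ (true  ∷ true  ∷ false ∷ []) ∷ (false ∷ true  ∷ false ∷ [])
  ∷ (false ∷ true  ∷ true  ∷ []) ∷ (false ∷ false ∷ true  ∷ []) ∷ (true  ∷ false ∷ true  ∷ []) ∷ [])

hexagonAround-walk : ∀ d → Walk (OffPair d) (d ⊕ (true ∷ false ∷ false ∷ []))
                                (d ⊕ (true ∷ false ∷ true ∷ [])) (hexagonAround d)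
hexagonAround-walk = from-yes (all-strings? λ d → walk? (offPair? d) (d ⊕ (true ∷ false ∷ false ∷ []))
                                (d ⊕ (true ∷ false ∷ true ∷ [])) (hexagonAround d))

hexagonAround-unique : ∀ d → Unique (hexagonAround d)
hexagonAround-unique = from-yes (all-strings? λ d → DecUnique.unique? _≟ᵛ_ (hexagonAround d))

hexagonAround-closed : ∀ (d : 𝔽₂^ 3) →
  distance (d ⊕ (true ∷ false ∷ true ∷ [])) (d ⊕ (true ∷ false ∷ false ∷ [])) ≡ 1
hexagonAround-closed = from-yes (all-strings? λ (d : 𝔽₂^ 3) →
  distance (d ⊕ (true ∷ false ∷ true ∷ [])) (d ⊕ (true ∷ false ∷ false ∷ [])) ≟ 1)

hexagonAround-complete : ∀ d v → OffPair d v → v ∈ hexagonAround d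
hexagonAround-complete = from-yes (all-strings? λ d → all-strings? λ v →
  offPair? d v →-dec member-of? _≟ᵛ_ v (hexagonAround d))

hamiltonian-3 : {D : Subset (𝔽₂^ 3)} → Separated D → Invariant (true ∷ true ∷ true ∷ []) D →
                ∀ {d} → d ∈ˢ D → Hamiltonian (Q 3 − D)
hamiltonian-3 {D} sep inv {d} d∈D = hexagonAround d ,
  proj₁ (walk⇒cycle walk (hexagonAround-unique d) (s≤s (s≤s (s≤s z≤n))) (hexagonAround-closed d)) ,
  λ {v} v∈ → hexagonAround-complete d v (∉⇒offPair sep inv d∈D v (vertex⇒∉ {D = D} v∈))
  where
  walk : Walk (_∉ˢ D) (d ⊕ (true ∷ false ∷ false ∷ [])) (d ⊕ (true ∷ false ∷ true ∷ []))
              (hexagonAround d)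
  walk = subst (Walk _ _ _) (List.map-id _)
    (walk-map id (λ _ _ → refl) (offPair⇒∉ sep inv d∈D) (hexagonAround-walk d))

-- Linear perfect codes

e₀+e₁ : 𝔽₂^ (2 + m)
e₀+e₁ = true ∷ true ∷ 𝟎

distance-𝟎-e₀+e₁ : ∀ m → distance 𝟎 (e₀+e₁ {m}) ≡ 2
distance-𝟎-e₀+e₁ m = cong (2 +_) (distance-refl (𝟎 {m}))

-- The codeword adjacent to e₀ + e₁ has weight at most 3, and it is not 0.
linear⇒weight-3 : {D : Subset (𝔽₂^ (2 + m))} → IsPerfectIndependentDominating (Q (2 + m)) D →
                  IsLinear D → ∃[ u ] u ∈ˢ D × distance 𝟎 u ≡ 3
linear⇒weight-3 {m} {D} pid lin = weight-3 (perfect (strings-complete e₀+e₁) e₀+e₁∉D)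
  where
  open IsPerfectIndependentDominating pid
  open IsLinear lin
  sep = perfect⇒separated pid
  e₀+e₁∉D : e₀+e₁ ∉ˢ D
  e₀+e₁∉D t∈D with () ← sep 𝟎 e₀+e₁ 0-mem t∈D (s≤s (≤-reflexive (distance-𝟎-e₀+e₁ m)))
  weight-3 : ∃! _≡_ (λ u → u ∈ˢ D × distance e₀+e₁ u ≡ 1) → ∃[ u ] u ∈ˢ D × distance 𝟎 u ≡ 3
  weight-3 (u , (u∈D , tu) , _) = u , u∈D , ≤-antisym
    (≤-trans (distance-triangle 𝟎 e₀+e₁ u) (≤-reflexive (cong₂ _+_ (distance-𝟎-e₀+e₁ m) tu)))
    (≮⇒≥ λ u<3 → contradiction
      (trans (sym (distance-𝟎-e₀+e₁ m)) (trans (distance-sym 𝟎 (e₀+e₁ {m}))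
        (trans (cong (distance (e₀+e₁ {m})) (sep 𝟎 u 0-mem u∈D u<3)) tu))) (λ ()))

coset-invariant : {D D₀ : Subset (𝔽₂^ n)} → IsLinear D₀ → D IsCosetOf D₀ →
                  ∀ {u} → u ∈ˢ D₀ → Invariant u D
coset-invariant {D = D} lin (x , coset) {u} u∈D₀ v v∈D
  with d , d∈D₀ , refl ← Equivalence.to (coset v) v∈D
  = Equivalence.from (coset ((d ⊕ x) ⊕ u)) (d ⊕ u , IsLinear.+-mem lin d∈D₀ u∈D₀ ,
      trans (assoc d x u) (trans (cong (d ⊕_) (zipWith-comm xor-comm x u)) (sym (assoc d u x))))
  where
  assoc = zipWith-assoc xor-assoc

bipancyclic-coset : {D D₀ : Subset (𝔽₂^ n)} → 4 ≤ n → Separated D →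
  IsPerfectIndependentDominating (Q n) D₀ → IsLinear D₀ → D IsCosetOf D₀ → EdgeBipancyclic (Q n − D)
bipancyclic-coset 4≤n sep pid₀ lin coset
  with m , refl ← m≤n⇒∃[o]m+o≡n 4≤n
  with u , u∈D₀ , |u|≡3 ← linear⇒weight-3 pid₀ lin
  = bipancyclic⇒edgeBipancyclic (bipancyclic m u |u|≡3 sep (coset-invariant lin coset u∈D₀))

hamiltonian-coset : {D D₀ : Subset (𝔽₂^ 3)} → IsPerfectIndependentDominating (Q 3) D →
  IsPerfectIndependentDominating (Q 3) D₀ → IsLinear D₀ → D IsCosetOf D₀ → Hamiltonian (Q 3 − D)
hamiltonian-coset pid pid₀ lin coset
  with u , u∈D₀ , |u|≡3 ← linear⇒weight-3 pid₀ lin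
  with refl ← weight≡3⇒ones u |u|≡3
  = hamiltonian-3 (perfect⇒separated pid) (coset-invariant lin coset u∈D₀)
      (proj₂ (perfect⇒nonempty pid))

perfect-card≤ : ∀ {n} {D : Subset (𝔽₂^ n)} → 1 ≤ n → IsPerfectIndependentDominating (Q n) D →
                ∀ S → Regular (n ∸ 1) (Q n − S) → card (Q n) D ≤ card (Q n) S
perfect-card≤ {suc n} {D} _ pid S reg =
  separated-card≤ D S (perfect⇒separated pid) (regular⇒∑ᴺ≡1 reg)

theorem6p1 : ∀ (k n : ℕ) → 2 ≤ k → n ≡ 2 ^ k ∸ 1 →
    ∀ (D : Subset (𝔽₂^ n)) → IsPerfectIndependentDominating (Q n) D →
    (Regular (n ∸ 1) (Q n − D) × VertexConnected (n ∸ 1) (Q n − D))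
    × ((∃[ D₀ ] IsPerfectIndependentDominating (Q n) D₀ × IsLinear D₀ × D IsCosetOf D₀) →
    (k ≡ 2 → Hamiltonian (Q n − D)) × (3 ≤ k → EdgeBipancyclic (Q n − D)))
    × (∀ (S : Subset (𝔽₂^ n)) →
    Regular (n ∸ 1) (Q n − S) → VertexConnected (n ∸ 1) (Q n − S) →
    card (Q n) D ≤ card (Q n) S)
theorem6p1 k n 2≤k refl D pid =
    (∑ᴺ≡1⇒regular (perfect⇒∑ᴺ≡1 pid) , perfect⇒vertexConnected n 1≤n pid)
  , (λ (D₀ , pid₀ , lin , coset) →
        (λ { refl → hamiltonian-coset pid pid₀ lin coset })
      , (λ 3≤k → bipancyclic-coset
          -- Here `n` is at least 2³ - 1 = 7 = 4 + 3.
          (≤-trans (m≤m+n 4 3) (∸-monoˡ-≤ 1 (^-monoʳ-≤ 2 3≤k)))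
          (perfect⇒separated pid) pid₀ lin coset))
  , (λ S reg _ → perfect-card≤ 1≤n pid S reg)
  where
  1≤n : 1 ≤ 2 ^ k ∸ 1
  1≤n = ≤-trans (m≤m+n 1 2) (∸-monoˡ-≤ 1 (^-monoʳ-≤ 2 2≤k))
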